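{- For every positive integer $n$ and every integer $k$ with $0 \le k \le n-1$, \[ R_{n,k} = D_{n,k}. \] Moreover, for $n \ge 2$ and $0 \le k \le n-1$, the numbers $R_{n,k}$ satisfy \[ R_{n,k} = \begin{cases} (n-k)R_{n-1,k-1} + (k+1)R_{n-1,k}, & \text{if } n \text{ is odd},\\ R_{n-1,k-1} - R_{n-1,k}, & \text{if } n \text{ is even},\end{cases} \] with the convention $R_{m,j} = 0$ when $j<0$ or $j > m-1$.
   Context: For a permutation $A = a_1a_2\cdots a_n$ of $[n]=\{1,\dots,n\}$, an ascent is an index $i$ ($1 \le i \le n-1$) with $a_i < a_{i+1}$, and an inversion is a pair $(i,j)$ with $1\le i<j\le n$ and $a_i > a_j$; ${\rm inv}(A)$ is the number of inversions, and $A$ is even (resp. odd) if ${\rm inv}(A)$ is even (resp. odd). Let $E(n,k)$ be the set of permutations of $[n]$ with exactly $k$ ascents, and let $B_{n,k}$, $C_{n,k}$ be the numbers of even, resp. odd, permutations in $E(n,k)$; the signed Eulerian number is $D_{n,k} = B_{n,k} - C_{n,k}$. A permutation is parity-alternate (a PAP) if its consecutive entries alternate between even and odd integers (e.g. $436125$, $7216345$). Let $\Xi(n,k)$ be the set of PAPs of $[n]$ with exactly $k$ ascents, $P_{n,k}$ the number of even permutations in $\Xi(n,k)$, $Q_{n,k}$ the number of odd ones, and $R_{n,k} = P_{n,k} - Q_{n,k}$. -}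

module Defs where

open import Data.Nat using (ℕ; zero; suc; _+_; _∸_; _≡ᵇ_; _<ᵇ_; _%_)
open import Data.Bool using (Bool; true; false; _∧_; not; if_then_else_)
open import Data.List using (List; []; _∷_; map; concatMap; length)
open import Data.Bool.ListAction using (all; any)
open import Data.Integer using (ℤ; +_; _-_; _<_; _≤?_; _<?_)
open import Relation.Nullary.Decidable using (⌊_⌋)

range1 : ℕ → List ℕ
range1 n = go n 1
  where
  go : ℕ → ℕ → List ℕ
  go zero    _ = []
  go (suc m) i = i ∷ go m (suc i)

words : ℕ → ℕ → List (List ℕ)
words n zero    = [] ∷ []
words n (suc l) = concatMap (λ a → map (a ∷_) (words n l)) (range1 n)

-- a word of length n over [1..n] is a permutation of [n] iff every i ∈ [n] occurs in it
isPermB : ℕ → List ℕ → Bool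
isPermB n xs = all (λ i → any (λ x → i ≡ᵇ x) xs) (range1 n)

perms : ℕ → List (List ℕ)
perms n = go (words n n)
  where
  go : List (List ℕ) → List (List ℕ)
  go []       = []
  go (w ∷ ws) = if isPermB n w then w ∷ go ws else go ws

asc : List ℕ → ℕ
asc []             = 0
asc (x ∷ [])       = 0
asc (x ∷ y ∷ ys)   = (if x <ᵇ y then 1 else 0) + asc (y ∷ ys)

inv : List ℕ → ℕ
inv []       = 0
inv (x ∷ xs) = countGt xs + inv xs
  where
  countGt : List ℕ → ℕ
  countGt []       = 0
  countGt (y ∷ ys) = (if y <ᵇ x then 1 else 0) + countGt ys

isEvenB : ℕ → Bool
isEvenB m = m % 2 ≡ᵇ 0

isPAPB : List ℕ → Bool
isPAPB []           = true
isPAPB (x ∷ [])     = true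
isPAPB (x ∷ y ∷ ys) = not (isEvenB x ≡ᵇB isEvenB y) ∧ isPAPB (y ∷ ys)
  where
  _≡ᵇB_ : Bool → Bool → Bool
  true  ≡ᵇB b = b
  false ≡ᵇB b = not b

count : (List ℕ → Bool) → List (List ℕ) → ℕ
count p []       = 0
count p (w ∷ ws) = (if p w then 1 else 0) + count p ws

B C : ℕ → ℕ → ℕ
B n k = count (λ w → (asc w ≡ᵇ k) ∧ isEvenB (inv w)) (perms n)
C n k = count (λ w → (asc w ≡ᵇ k) ∧ not (isEvenB (inv w))) (perms n)

D : ℕ → ℕ → ℤ
D n k = + B n k - + C n k

P Q : ℕ → ℕ → ℕ
P n k = count (λ w → isPAPB w ∧ (asc w ≡ᵇ k) ∧ isEvenB (inv w)) (perms n)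
Q n k = count (λ w → isPAPB w ∧ (asc w ≡ᵇ k) ∧ not (isEvenB (inv w))) (perms n)

R : ℕ → ℕ → ℤ
R n k = + P n k - + Q n k

Rc : ℕ → ℤ → ℤ
Rc m (+ j)    = if ⌊ + j Data.Integer.≤? (+ m - + 1) ⌋ then R m j else + 0
Rc m (ℤ.negsuc _) = + 0

{-# OPTIONS --safe #-}
-- Read a permutation through the positions of its values.  If v and v + 1 are not adjacent,
-- exchanging them keeps all ascents and reverses the sign.  A permutation is parity-alternate
-- exactly when the positions of v and v + 1 have opposite parities for every v; at the first v
-- where they do not, v and v + 1 are not adjacent, so the other permutations cancel and R = D.
--
-- The same exchange of n - 1 and n leaves the permutations of [n] in which these are adjacent,
-- i.e. a block inserted into a permutation of [n - 2].  Counting the ascents created gives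
-- Dₙ = Δ (euler (n - 1) Dₙ₋₂), where Δ is multiplication by t - 1 and euler N the Eulerian operator.
-- Since euler (N + 1) ∘ Δ = Δ ∘ euler N, the two one-step recurrences follow from each other.
module Submission where

open import Defs
open import Data.Nat using (ℕ; zero; suc; _≤_; _<_; _∸_; _%_; z≤n; s≤s; _≡ᵇ_; _<ᵇ_)
open import Data.Integer using (ℤ; +_; _-_; _+_; _*_; -_; 0ℤ; 1ℤ)
open import Data.Product using (_×_; _,_; ∃; ∃₂; proj₁; proj₂)
open import Relation.Binary.PropositionalEquality as ≡ using (_≡_; _≢_; refl; sym; trans; cong; cong₂; subst;
  module ≡-Reasoning)

open import Data.Bool using (Bool; true; false; T; not; _∧_; _∨_; _xor_; if_then_else_)
import Data.Bool.Properties as Bool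
import Data.Integer.Properties as ℤ
open import Data.Integer.Tactic.RingSolver using (solve-∀)
open import Data.List using (List; []; _∷_; _++_; map; concatMap; length; applyUpTo; filter; filterᵇ;
  cartesianProduct; cartesianProductWith)
open import Data.List.Membership.Propositional using (_∈_; _∉_; find; lose)
open import Data.List.Membership.Propositional.Properties
open import Data.List.Membership.Propositional.Properties.WithK using (unique∧set⇒bag)
import Data.List.Properties as List
open import Data.List.Relation.Binary.BagAndSetEquality using (∼bag⇒↭)
open import Data.List.Relation.Binary.Permutation.Propositional using (_↭_; ↭-refl; ↭-sym; ↭-trans; ↭⇒↭ₛ;
  refl; prep; swap)
open import Data.List.Relation.Binary.Permutation.Propositional.Properties as ↭ using (∈-resp-↭; ↭-length)
import Data.List.Relation.Binary.Permutation.Setoid.Properties as ↭ₛ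
open import Data.List.Relation.Binary.Subset.Propositional using (_⊆_)
open import Data.List.Relation.Unary.All as All using (All; []; _∷_)
import Data.List.Relation.Unary.All.Properties as All
open import Data.List.Relation.Unary.AllPairs using ([]; _∷_)
open import Data.List.Relation.Unary.Any as Any using (here; there)
import Data.List.Relation.Unary.Any.Properties as Any
open import Data.List.Relation.Unary.Unique.Propositional using (Unique)
import Data.List.Relation.Unary.Unique.Propositional.Properties as Unique
import Data.Nat as ℕ
import Data.Nat.Properties as ℕ
open import Data.Sum using (_⊎_; inj₁; inj₂)
open import Function using (_∘_; Equivalence; mk⇔)
open import Relation.Nullary using (yes; no; contradiction)

private variable A X : Set

-- The list `perms n`: duplicate-free rearrangements of `range1 n`

applyUpTo-cong : ∀ {A : Set} {f g : ℕ → A} → (∀ j → f j ≡ g j) → ∀ n → applyUpTo f n ≡ applyUpTo g n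
applyUpTo-cong f≗g zero    = refl
applyUpTo-cong f≗g (suc n) = cong₂ _∷_ (f≗g 0) (applyUpTo-cong (f≗g ∘ suc) n)

-- The local functions of Defs cannot be named here; once their argument is abstracted by a
-- with, unification supplies them for the _ in the type of the second function.
mutual
  range1-applyUpTo : ∀ n → range1 n ≡ applyUpTo suc n
  range1-applyUpTo n with 1 in eq
  ... | i = trans (count-from n i) (applyUpTo-cong (λ j → cong (ℕ._+ j) (sym eq)) n)

  count-from : ∀ m i → _ ≡ applyUpTo (i ℕ.+_) m
  count-from zero    i = refl
  count-from (suc m) i = cong₂ _∷_ (sym (ℕ.+-identityʳ i))
                           (trans (count-from m (suc i)) (applyUpTo-cong (λ j → sym (ℕ.+-suc i j)) m))

mutual
  perms-filter : ∀ n → perms n ≡ filterᵇ (isPermB n) (words n n)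
  perms-filter n with words n n
  ... | ws = filter-perms n ws

  filter-perms : ∀ n ws → _ ≡ filterᵇ (isPermB n) ws
  filter-perms n []       = refl
  filter-perms n (w ∷ ws) with isPermB n w
  ... | true  = cong (w ∷_) (filter-perms n ws)
  ... | false = filter-perms n ws

∈-range1⁺ : ∀ {n i} → i < n → suc i ∈ range1 n
∈-range1⁺ {n} i<n rewrite range1-applyUpTo n = ∈-applyUpTo⁺ suc i<n

∈-range1⁻ : ∀ {n x} → x ∈ range1 n → ∃ λ i → i < n × x ≡ suc i
∈-range1⁻ {n} x∈ rewrite range1-applyUpTo n = ∈-applyUpTo⁻ suc x∈

range1-unique : ∀ n → Unique (range1 n)
range1-unique n rewrite range1-applyUpTo n =
  Unique.applyUpTo⁺₁ suc n λ i<j _ → ℕ.<⇒≢ (s≤s i<j)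

length-range1 : ∀ n → length (range1 n) ≡ n
length-range1 n rewrite range1-applyUpTo n = List.length-applyUpTo suc n

range1-suc : ∀ n → range1 (suc n) ↭ suc n ∷ range1 n
range1-suc n rewrite range1-applyUpTo (suc n) | range1-applyUpTo n
  | sym (List.applyUpTo-∷ʳ suc n) = ↭-sym (↭.∷↭∷ʳ (suc n) (applyUpTo suc n))

words-product : ∀ n l → words n (suc l) ≡ cartesianProductWith _∷_ (range1 n) (words n l)
words-product n l = product (range1 n)
  where
  product : ∀ as → concatMap (λ a → map (a ∷_) (words n l)) as ≡ cartesianProductWith _∷_ as (words n l)
  product []       = refl
  product (a ∷ as) = cong (map (a ∷_) (words n l) ++_) (product as)

words-unique : ∀ n l → Unique (words n l)
words-unique n zero    = [] ∷ []
words-unique n (suc l) rewrite words-product n l =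
  Unique.cartesianProductWith⁺ _∷_ List.∷-injective (range1-unique n) (words-unique n l)

∈-words⁺ : ∀ n w → All (_∈ range1 n) w → w ∈ words n (length w)
∈-words⁺ n []      []       = here refl
∈-words⁺ n (x ∷ w) (p ∷ ps) rewrite words-product n (length w) =
  ∈-cartesianProductWith⁺ _∷_ p (∈-words⁺ n w ps)

∈-words⁻ : ∀ n l {w} → w ∈ words n l → length w ≡ l
∈-words⁻ n zero    (here refl) = refl
∈-words⁻ n (suc l) w∈ rewrite words-product n l
  with _ , _ , _ , v∈ , refl ← ∈-cartesianProductWith⁻ _∷_ (range1 n) (words n l) w∈
  = cong suc (∈-words⁻ n l v∈)

-- Pigeonhole principle by induction: cutting the head of `xs` out of `ys` shortens both lists by
-- one, and the rest of `xs` still fits because the head does not recur in it.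
⊆∧length⇒↭ : ∀ {A : Set} {xs ys : List A} → Unique xs → xs ⊆ ys → length ys ≤ length xs → xs ↭ ys
⊆∧length⇒↭ {xs = []}     {[]}    _ _ _ = ↭-refl
⊆∧length⇒↭ {xs = x ∷ xs} (x∉xs ∷ uxs) xs⊆ys len with ∈-∃++ (xs⊆ys (here refl))
... | as , bs , refl = ↭-trans (prep x (⊆∧length⇒↭ uxs xs⊆ len′)) (↭-sym (↭.shift x as bs))
  where
  len′ : length (as ++ bs) ≤ length xs
  len′ = ℕ.≤-pred (ℕ.≤-trans (ℕ.≤-reflexive (sym (↭-length (↭.shift x as bs)))) len)
  xs⊆ : xs ⊆ as ++ bs
  xs⊆ z∈ with ∈-resp-↭ (↭.shift x as bs) (xs⊆ys (there z∈))
  ... | here refl = contradiction refl (All.lookup x∉xs z∈)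
  ... | there z∈′ = z∈′

isPermB⁺ : ∀ n {w} → range1 n ⊆ w → T (isPermB n w)
isPermB⁺ n r⊆w = All.all⁻ _ (All.tabulate λ i∈ → Any.any⁺ _ (Any.map (ℕ.≡⇒≡ᵇ _ _) (r⊆w i∈)))

isPermB⁻ : ∀ n {w} → T (isPermB n w) → range1 n ⊆ w
isPermB⁻ n {w} p i∈ = Any.map (ℕ.≡ᵇ⇒≡ _ _) (Any.any⁻ _ w (All.lookup (All.all⁺ _ (range1 n) p) i∈))

∈-perms⁺ : ∀ n {w} → w ↭ range1 n → w ∈ perms n
∈-perms⁺ n {w} w↭ rewrite perms-filter n =
  ∈-filter⁺ (Bool.T? ∘ isPermB n)
    (subst (λ l → w ∈ words n l) (trans (↭-length w↭) (length-range1 n))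
      (∈-words⁺ n w (All.tabulate (∈-resp-↭ w↭))))
    (isPermB⁺ n (∈-resp-↭ (↭-sym w↭)))

∈-perms⁻ : ∀ n {w} → w ∈ perms n → w ↭ range1 n
∈-perms⁻ n {w} w∈ rewrite perms-filter n
  with w∈words , p ← ∈-filter⁻ (Bool.T? ∘ isPermB n) {xs = words n n} w∈
  -- The test only says that every value occurs; length n then leaves no room for repetitions or
  -- foreign entries.
  = ↭-sym (⊆∧length⇒↭ (range1-unique n) (isPermB⁻ n p)
      (ℕ.≤-reflexive (trans (∈-words⁻ n n w∈words) (sym (length-range1 n)))))

perms-unique : ∀ n → Unique (perms n)
perms-unique n rewrite perms-filter n = Unique.filter⁺ (Bool.T? ∘ isPermB n) (words-unique n n)

-- Integer sums over lists

∑ : (A → ℤ) → List A → ℤ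
∑ f []       = 0ℤ
∑ f (x ∷ xs) = f x + ∑ f xs

∑-cong : ∀ {f g : A → ℤ} xs → (∀ {x} → x ∈ xs → f x ≡ g x) → ∑ f xs ≡ ∑ g xs
∑-cong []       f≗g = refl
∑-cong (x ∷ xs) f≗g = cong₂ _+_ (f≗g (here refl)) (∑-cong xs (f≗g ∘ there))

∑-↭ : ∀ (f : A → ℤ) {xs ys} → xs ↭ ys → ∑ f xs ≡ ∑ f ys
∑-↭ f refl = refl
∑-↭ f (prep x p) = cong (λ s → f x + s) (∑-↭ f p)
∑-↭ f (swap {xs} {ys} x y p) rewrite ∑-↭ f p = exchange (f x) (f y) (∑ f ys)
  where
  exchange : ∀ a b c → a + (b + c) ≡ b + (a + c)
  exchange = solve-∀
∑-↭ f (_↭_.trans p q) = trans (∑-↭ f p) (∑-↭ f q)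

∑-map : ∀ (f : X → ℤ) (g : A → X) xs → ∑ f (map g xs) ≡ ∑ (f ∘ g) xs
∑-map f g []       = refl
∑-map f g (x ∷ xs) = cong (λ s → f (g x) + s) (∑-map f g xs)

∑-++ : ∀ (f : A → ℤ) xs ys → ∑ f (xs ++ ys) ≡ ∑ f xs + ∑ f ys
∑-++ f []       ys = sym (ℤ.+-identityˡ _)
∑-++ f (x ∷ xs) ys rewrite ∑-++ f xs ys = sym (ℤ.+-assoc (f x) _ _)

∑-concatMap : ∀ (f : X → ℤ) (g : A → List X) xs → ∑ f (concatMap g xs) ≡ ∑ (∑ f ∘ g) xs
∑-concatMap f g []       = refl
∑-concatMap f g (x ∷ xs) rewrite ∑-++ f (g x) (concatMap g xs) = cong (λ s → ∑ f (g x) + s) (∑-concatMap f g xs)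

∑-+ : ∀ (f g : A → ℤ) xs → ∑ (λ x → f x + g x) xs ≡ ∑ f xs + ∑ g xs
∑-+ f g []       = refl
∑-+ f g (x ∷ xs) rewrite ∑-+ f g xs = interchange (f x) (g x) (∑ f xs) (∑ g xs)
  where
  interchange : ∀ a b c d → a + b + (c + d) ≡ a + c + (b + d)
  interchange = solve-∀

∑-* : ∀ c (f : A → ℤ) xs → ∑ (λ x → c * f x) xs ≡ c * ∑ f xs
∑-* c f []       = sym (ℤ.*-zeroʳ c)
∑-* c f (x ∷ xs) rewrite ∑-* c f xs = sym (ℤ.*-distribˡ-+ c (f x) (∑ f xs))

infixr 7 [_]*_

[_]*_ : Bool → ℤ → ℤ
[ b ]* z = if b then z else 0ℤ

∑-filterᵇ : ∀ (p : A → Bool) f xs → ∑ f (filterᵇ p xs) ≡ ∑ (λ x → [ p x ]* f x) xs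
∑-filterᵇ p f []       = refl
∑-filterᵇ p f (x ∷ xs) with p x
... | true  = cong (λ s → f x + s) (∑-filterᵇ p f xs)
... | false = trans (∑-filterᵇ p f xs) (sym (ℤ.+-identityˡ _))

∑-split : ∀ (p : A → Bool) f xs → ∑ f xs ≡ ∑ (λ x → [ p x ]* f x) xs + ∑ (λ x → [ not (p x) ]* f x) xs
∑-split p f xs = trans (∑-cong xs (λ {x} _ → split (p x) (f x))) (∑-+ _ _ xs)
  where
  split : ∀ b z → z ≡ [ b ]* z + [ not b ]* z
  split true  z = sym (ℤ.+-identityʳ z)
  split false z = sym (ℤ.+-identityˡ z)

-- An involution that maps `xs` into itself rearranges it, so the sum equals its own negative.
∑-sign-reversing : ∀ {f : A → ℤ} {φ : A → A} {xs} → Unique xs →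
  (∀ {x} → x ∈ xs → φ x ∈ xs) → (∀ x → φ (φ x) ≡ x) →
  (∀ {x} → x ∈ xs → f (φ x) ≡ - f x) → ∑ f xs ≡ 0ℤ
∑-sign-reversing {f = f} {φ} {xs} uxs closed invol neg = self-neg (begin
  ∑ f xs                        ≡⟨ ∑-↭ f (⊆∧length⇒↭ uxs ⊆map (ℕ.≤-reflexive (List.length-map φ xs))) ⟩
  ∑ f (map φ xs)                ≡⟨ ∑-map f φ xs ⟩
  ∑ (f ∘ φ) xs                  ≡⟨ ∑-cong xs (λ x∈ → trans (neg x∈) (sym (ℤ.-1*i≡-i _))) ⟩
  ∑ (λ x → - 1ℤ * f x) xs       ≡⟨ ∑-* (- 1ℤ) f xs ⟩
  - 1ℤ * ∑ f xs                 ≡⟨ ℤ.-1*i≡-i _ ⟩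
  - ∑ f xs                      ∎)
  where
  open ≡-Reasoning
  ⊆map : ∀ {x} → x ∈ xs → x ∈ map φ xs
  ⊆map {x} x∈ = subst (_∈ map φ xs) (invol x) (∈-map⁺ φ (closed x∈))
  self-neg : ∀ {z} → z ≡ - z → z ≡ 0ℤ
  -- A nonzero integer and its negative have different constructors, so no other case arises.
  self-neg {+ zero} _ = refl

-- Signs and signed counts

ε : ℕ → ℤ
ε zero    = 1ℤ
ε (suc n) = - ε n

ε-+ : ∀ m n → ε (m ℕ.+ n) ≡ ε m * ε n
ε-+ zero    n = sym (ℤ.*-identityˡ _)
ε-+ (suc m) n rewrite ε-+ m n = ℤ.neg-distribˡ-* (ε m) (ε n)

ε-double : ∀ m → ε (m ℕ.+ m) ≡ 1ℤ
ε-double zero    = refl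
ε-double (suc m) rewrite ℕ.+-suc m m = trans (ℤ.neg-involutive _) (ε-double m)

isEvenB-suc : ∀ n → isEvenB (suc n) ≡ not (isEvenB n)
isEvenB-suc zero          = refl
isEvenB-suc (suc zero)    = refl
isEvenB-suc (suc (suc n)) = isEvenB-suc n

ε-isEvenB : ∀ n → ε n ≡ (if isEvenB n then 1ℤ else - 1ℤ)
ε-isEvenB zero = refl
ε-isEvenB (suc n) rewrite ε-isEvenB n | isEvenB-suc n with isEvenB n
... | true  = refl
... | false = refl

-- The coefficient of tᵏ in the signed weight (-1)^inv(w) t^asc(w).
χ : ℕ → List ℕ → ℤ
χ k w = [ asc w ≡ᵇ k ]* ε (inv w)

-- Both predicates stay abstract so that one induction serves `D`, where `p` tests the ascents, and
-- `R`, where it also tests parity alternation.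
count-signed : ∀ (p e : List ℕ → Bool) → (∀ w → ε (inv w) ≡ (if e w then 1ℤ else - 1ℤ)) → ∀ ws →
  + count (λ w → p w ∧ e w) ws - + count (λ w → p w ∧ not (e w)) ws ≡ ∑ (λ w → [ p w ]* ε (inv w)) ws
count-signed p e ε≡ [] = refl
count-signed p e ε≡ (w ∷ ws) rewrite sym (count-signed p e ε≡ ws) | ε≡ w with p w | e w
... | true  | true  = step (+ count (λ w → p w ∧ e w) ws) (+ count (λ w → p w ∧ not (e w)) ws)
  where step : ∀ a b → 1ℤ + a - b ≡ 1ℤ + (a - b)
        step = solve-∀
... | true  | false = step (+ count (λ w → p w ∧ e w) ws) (+ count (λ w → p w ∧ not (e w)) ws)
  where step : ∀ a b → a - (1ℤ + b) ≡ - 1ℤ + (a - b)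
        step = solve-∀
... | false | _     = sym (ℤ.+-identityˡ _)

D-∑ : ∀ n k → D n k ≡ ∑ (χ k) (perms n)
D-∑ n k = count-signed (λ w → asc w ≡ᵇ k) (isEvenB ∘ inv) (ε-isEvenB ∘ inv) (perms n)

count-cong : ∀ {p q} → (∀ w → p w ≡ q w) → ∀ ws → count p ws ≡ count q ws
count-cong p≗q []       = refl
count-cong p≗q (w ∷ ws) = cong₂ (λ b c → (if b then 1 else 0) ℕ.+ c) (p≗q w) (count-cong p≗q ws)

R-∑ : ∀ n k → R n k ≡ ∑ (λ w → [ isPAPB w ]* χ k w) (perms n)
R-∑ n k = begin
  R n k
    -- Reassociation isolates the sign test as the last conjunct, the shape that `count-signed`
    -- expects.
    ≡⟨ cong₂ (λ a b → + a - + b)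
         (count-cong (λ w → sym (Bool.∧-assoc (isPAPB w) (asc w ≡ᵇ k) (isEvenB (inv w)))) (perms n))
         (count-cong (λ w → sym (Bool.∧-assoc (isPAPB w) (asc w ≡ᵇ k) (not (isEvenB (inv w))))) (perms n)) ⟩
  _
    ≡⟨ count-signed (λ w → isPAPB w ∧ (asc w ≡ᵇ k)) (isEvenB ∘ inv) (ε-isEvenB ∘ inv) (perms n) ⟩
  ∑ (λ w → [ isPAPB w ∧ (asc w ≡ᵇ k) ]* ε (inv w)) (perms n)
    ≡⟨ ∑-cong (perms n) (λ {w} _ → nested (isPAPB w) (asc w ≡ᵇ k) (ε (inv w))) ⟩
  ∑ (λ w → [ isPAPB w ]* χ k w) (perms n) ∎
  where
  open ≡-Reasoning
  nested : ∀ b c z → [ b ∧ c ]* z ≡ [ b ]* [ c ]* z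
  nested true  c z = refl
  nested false c z = refl

-- Inversions and ascents under the exchange of v and v + 1

cnt : ℕ → List ℕ → ℕ
cnt x []       = 0
cnt x (y ∷ ys) = (if y <ᵇ x then 1 else 0) ℕ.+ cnt x ys

-- countGt is local to inv: its value is read off the induction hypothesis by cancelling inv ys.
inv-∷ : ∀ x xs → inv (x ∷ xs) ≡ cnt x xs ℕ.+ inv xs
inv-∷ x []       = refl
inv-∷ x (y ∷ ys) = cong (λ c → (if y <ᵇ x then 1 else 0) ℕ.+ c ℕ.+ inv (y ∷ ys))
                     (ℕ.+-cancelʳ-≡ (inv ys) _ _ (inv-∷ x ys))

-- The transposition of v and v + 1, by recursion instead of equality tests, so that comparisons of
-- its values reduce along with `_<ᵇ_` and `_≡ᵇ_`.
sw : ℕ → ℕ → ℕ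
sw zero    zero          = 1
sw zero    (suc zero)    = 0
sw zero    (suc (suc x)) = suc (suc x)
sw (suc v) zero          = zero
sw (suc v) (suc x)       = suc (sw v x)

sw-v : ∀ v → sw v v ≡ suc v
sw-v zero    = refl
sw-v (suc v) = cong suc (sw-v v)

sw-suc : ∀ v → sw v (suc v) ≡ v
sw-suc zero    = refl
sw-suc (suc v) = cong suc (sw-suc v)

sw-other : ∀ {v x} → x ≢ v → x ≢ suc v → sw v x ≡ x
sw-other {zero}  {zero}        x≢v _ = contradiction refl x≢v
sw-other {zero}  {suc zero}    _ x≢1 = contradiction refl x≢1
sw-other {zero}  {suc (suc x)} _ _   = refl
sw-other {suc v} {zero}        _ _   = refl
sw-other {suc v} {suc x}       p q   = cong suc (sw-other (p ∘ cong suc) (q ∘ cong suc))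

sw-involutive : ∀ v x → sw v (sw v x) ≡ x
sw-involutive zero    zero          = refl
sw-involutive zero    (suc zero)    = refl
sw-involutive zero    (suc (suc x)) = refl
sw-involutive (suc v) zero          = refl
sw-involutive (suc v) (suc x)       = cong suc (sw-involutive v x)

sw-injective : ∀ v {x y} → sw v x ≡ sw v y → x ≡ y
sw-injective v {x} {y} eq = trans (sym (sw-involutive v x)) (trans (cong (sw v) eq) (sw-involutive v y))

map-sw-involutive : ∀ v w → map (sw v) (map (sw v) w) ≡ w
map-sw-involutive v w = trans (sym (List.map-∘ w)) (trans (List.map-cong (sw-involutive v) w) (List.map-id w))

isPair : ℕ → ℕ → ℕ → Bool
isPair v x y = ((x ≡ᵇ v) ∧ (y ≡ᵇ suc v)) ∨ ((x ≡ᵇ suc v) ∧ (y ≡ᵇ v))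

isPair⁻ : ∀ v x y → isPair v x y ≡ true → (x ≡ v × y ≡ suc v) ⊎ (x ≡ suc v × y ≡ v)
isPair⁻ zero zero (suc zero) _ = inj₁ (refl , refl)
isPair⁻ zero (suc zero) zero _ = inj₂ (refl , refl)
isPair⁻ (suc v) (suc x) (suc y) eq with isPair⁻ v x y eq
... | inj₁ (p , q) = inj₁ (cong suc p , cong suc q)
... | inj₂ (p , q) = inj₂ (cong suc p , cong suc q)
isPair⁻ (suc v) (suc x) zero eq with x ≡ᵇ v | x ≡ᵇ suc v
isPair⁻ (suc v) (suc x) zero () | true | true
isPair⁻ (suc v) (suc x) zero () | true | false
isPair⁻ (suc v) (suc x) zero () | false | true
isPair⁻ (suc v) (suc x) zero () | false | false
isPair⁻ zero (suc zero) (suc zero) ()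
isPair⁻ zero (suc zero) (suc (suc y)) ()

isPair-v : ∀ v → isPair v v (suc v) ≡ true
isPair-v zero    = refl
isPair-v (suc v) = isPair-v v

isPair-suc : ∀ v → isPair v (suc v) v ≡ true
isPair-suc zero    = refl
isPair-suc (suc v) = isPair-suc v

isPair-sw : ∀ v x y → isPair v (sw v x) (sw v y) ≡ isPair v x y
isPair-sw v x y = trans (cong₂ (λ a b → (a ∧ (sw v y ≡ᵇ suc v)) ∨ (b ∧ (sw v y ≡ᵇ v))) (hit x) (hit′ x))
  (trans (cong₂ (λ a b → ((x ≡ᵇ suc v) ∧ a) ∨ ((x ≡ᵇ v) ∧ b)) (hit′ y) (hit y))
    (Bool.∨-comm _ ((x ≡ᵇ v) ∧ (y ≡ᵇ suc v))))
  where
  hit : ∀ {v} x → (sw v x ≡ᵇ v) ≡ (x ≡ᵇ suc v)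
  hit {zero} zero = refl
  hit {zero} (suc zero) = refl
  hit {zero} (suc (suc x)) = refl
  hit {suc v} zero = refl
  hit {suc v} (suc x) = hit x
  hit′ : ∀ {v} x → (sw v x ≡ᵇ suc v) ≡ (x ≡ᵇ v)
  hit′ {zero} zero = refl
  hit′ {zero} (suc zero) = refl
  hit′ {zero} (suc (suc x)) = refl
  hit′ {suc v} zero = refl
  hit′ {suc v} (suc x) = hit′ x

-- No value lies strictly between v and v + 1, so the exchange can only reverse the comparison of
-- these two with each other.
sw-<ᵇ : ∀ v x y → isPair v x y ≡ false → (sw v x <ᵇ sw v y) ≡ (x <ᵇ y)
sw-<ᵇ zero zero zero _ = refl
sw-<ᵇ zero zero (suc (suc y)) _ = refl
sw-<ᵇ zero (suc zero) (suc zero) _ = refl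
sw-<ᵇ zero (suc zero) (suc (suc y)) _ = refl
sw-<ᵇ zero (suc (suc x)) zero _ = refl
sw-<ᵇ zero (suc (suc x)) (suc zero) _ = refl
sw-<ᵇ zero (suc (suc x)) (suc (suc y)) _ = refl
sw-<ᵇ (suc v) zero zero _ = refl
sw-<ᵇ (suc v) zero (suc y) _ = refl
sw-<ᵇ (suc v) (suc x) zero _ = refl
sw-<ᵇ (suc v) (suc x) (suc y) eq = sw-<ᵇ v x y eq

adjacent : ℕ → List ℕ → Bool
adjacent v []           = false
adjacent v (x ∷ [])     = false
adjacent v (x ∷ y ∷ ys) = isPair v x y ∨ adjacent v (y ∷ ys)

adjacent-sw : ∀ v w → adjacent v (map (sw v) w) ≡ adjacent v w
adjacent-sw v []           = refl
adjacent-sw v (x ∷ [])     = refl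
adjacent-sw v (x ∷ y ∷ ys) = cong₂ _∨_ (isPair-sw v x y) (adjacent-sw v (y ∷ ys))

asc-sw : ∀ v w → adjacent v w ≡ false → asc (map (sw v) w) ≡ asc w
asc-sw v []           _ = refl
asc-sw v (x ∷ [])     _ = refl
asc-sw v (x ∷ y ∷ ys) nadj = cong₂ (λ b a → (if b then 1 else 0) ℕ.+ a)
  (sw-<ᵇ v x y (Bool.∨-conicalˡ _ (adjacent v (y ∷ ys)) nadj))
  (asc-sw v (y ∷ ys) (Bool.∨-conicalʳ (isPair v x y) _ nadj))

cnt-sw : ∀ v x xs → (∀ {y} → y ∈ xs → isPair v y x ≡ false) → cnt (sw v x) (map (sw v) xs) ≡ cnt x xs
cnt-sw v x []       _  = refl
cnt-sw v x (y ∷ ys) np = cong₂ (λ b c → (if b then 1 else 0) ℕ.+ c) (sw-<ᵇ v y x (np (here refl)))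
                           (cnt-sw v x ys (np ∘ there))

notPair : ∀ v x y → (x ≡ v → y ≢ suc v) → (x ≡ suc v → y ≢ v) → isPair v x y ≡ false
notPair v x y p q with isPair v x y in eq
... | false = refl
... | true with isPair⁻ v x y eq
...   | inj₁ (a , b) = contradiction b (p a)
...   | inj₂ (a , b) = contradiction b (q a)

-- With at most one of the two values present, the exchange is an order-preserving relabelling.
inv-sw-fixed : ∀ v w → (v ∈ w → suc v ∉ w) → inv (map (sw v) w) ≡ inv w
inv-sw-fixed v []       _ = refl
inv-sw-fixed v (x ∷ xs) nb
  rewrite inv-∷ (sw v x) (map (sw v) xs) | inv-∷ x xs
  = cong₂ ℕ._+_
      (cnt-sw v x xs λ {y} y∈ → notPair v y x (λ { refl refl → nb (there y∈) (here refl) })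
                                    (λ { refl refl → nb (here refl) (there y∈) }))
      (inv-sw-fixed v xs λ p q → nb (there p) (there q))

n<ᵇ1+n : ∀ n → (n <ᵇ suc n) ≡ true
n<ᵇ1+n zero    = refl
n<ᵇ1+n (suc n) = n<ᵇ1+n n

1+n≮ᵇn : ∀ n → (suc n <ᵇ n) ≡ false
1+n≮ᵇn zero    = refl
1+n≮ᵇn (suc n) = 1+n≮ᵇn n

-- The count of a head that turns from v into v + 1: the former v + 1 behind it becomes v and is now
-- smaller than the head, and no other comparison changes.
cnt-sw-v : ∀ v xs → Unique xs → v ∉ xs → suc v ∈ xs → cnt (suc v) (map (sw v) xs) ≡ suc (cnt v xs)
cnt-sw-v v (y ∷ ys) (y∉ ∷ u) v∉ (here refl)
  rewrite sw-suc v | n<ᵇ1+n v | 1+n≮ᵇn v = cong suc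
    (trans (cong (λ z → cnt z (map (sw v) ys)) (sym (sw-v v)))
      (cnt-sw v v ys λ {z} z∈ → notPair v z v (λ { refl → contradiction (there z∈) v∉ })
                                    (λ { refl → contradiction refl (All.lookup y∉ z∈) })))
cnt-sw-v v (y ∷ ys) (y∉ ∷ u) v∉ (there sv∈) = begin
  (if sw v y <ᵇ suc v then 1 else 0) ℕ.+ cnt (suc v) (map (sw v) ys)
    ≡⟨ cong₂ (λ b c → (if b then 1 else 0) ℕ.+ c)
         (trans (cong (sw v y <ᵇ_) (sym (sw-v v)))
           (sw-<ᵇ v y v (notPair v y v (λ { refl → contradiction (here refl) v∉ })
                                 (λ { refl → contradiction refl (All.lookup y∉ sv∈) }))))
         (cnt-sw-v v ys u (v∉ ∘ there) sv∈) ⟩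
  (if y <ᵇ v then 1 else 0) ℕ.+ suc (cnt v ys)
    ≡⟨ ℕ.+-suc _ _ ⟩
  suc (cnt v (y ∷ ys)) ∎
  where open ≡-Reasoning

sign-sw-v : ∀ v xs → Unique (v ∷ xs) → suc v ∈ xs → ε (inv (map (sw v) (v ∷ xs))) ≡ - ε (inv (v ∷ xs))
sign-sw-v v xs (v∉ ∷ u) sv∈ rewrite sw-v v | inv-∷ (suc v) (map (sw v) xs) | inv-∷ v xs
  | cnt-sw-v v xs u (λ v∈ → All.lookup v∉ v∈ refl) sv∈
  | inv-sw-fixed v xs (λ v∈ → contradiction refl (All.lookup v∉ v∈)) = refl

-- Exactly one inversion appears or disappears, the one between v and v + 1. The induction walks
-- down to whichever of them comes first.
sign-sw : ∀ v w → Unique w → v ∈ w → suc v ∈ w → ε (inv (map (sw v) w)) ≡ - ε (inv w)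
sign-sw v (x ∷ xs) u (here refl) (there sv∈) = sign-sw-v v xs u sv∈
-- Here v + 1 leads. The exchanged word starts with v, so `sign-sw-v` applies to it, and exchanging
-- once more gives back the original.
sign-sw v (x ∷ xs) u (there v∈) (here refl) = begin
  ε (inv (map (sw v) w))                   ≡⟨ ℤ.neg-involutive _ ⟨
  - - ε (inv (map (sw v) w))               ≡⟨ cong -_ flipped ⟨
  - ε (inv (map (sw v) (map (sw v) w)))    ≡⟨ cong (λ z → - ε (inv z)) (map-sw-involutive v w) ⟩
  - ε (inv w)                              ∎
  where
  open ≡-Reasoning
  w = suc v ∷ xs
  flipped : ε (inv (map (sw v) (map (sw v) w))) ≡ - ε (inv (map (sw v) w))
  flipped = subst (λ z → ε (inv (map (sw v) z)) ≡ - ε (inv z)) (sym head)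
    (sign-sw-v v (map (sw v) xs) (subst Unique head (Unique.map⁺ (sw-injective v) u))
      (subst (_∈ map (sw v) xs) (sw-v v) (∈-map⁺ (sw v) v∈)))
    where
    head : map (sw v) w ≡ v ∷ map (sw v) xs
    head = cong (_∷ map (sw v) xs) (sw-suc v)
-- The head is neither value, so its own count is unchanged and contributes the same factor on both
-- sides.
sign-sw v (x ∷ xs) (x∉ ∷ u) (there v∈) (there sv∈)
  rewrite inv-∷ (sw v x) (map (sw v) xs) | inv-∷ x xs
  | cnt-sw v x xs (λ {y} y∈ → notPair v y x (λ { refl refl → All.lookup x∉ sv∈ refl })
                                      (λ { refl refl → All.lookup x∉ v∈ refl }))
  | ε-+ (cnt x xs) (inv (map (sw v) xs)) | ε-+ (cnt x xs) (inv xs) | sign-sw v xs u v∈ sv∈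
  = sym (ℤ.neg-distribʳ-* (ε (cnt x xs)) (ε (inv xs)))
sign-sw v (x ∷ xs) u (here refl) (here ())

-- The exchange as a sign-reversing involution on permutations

Unique-perm : ∀ {n w} → w ∈ perms n → Unique w
Unique-perm {n} w∈ = ↭ₛ.Unique-resp-↭ (≡.setoid ℕ) (↭⇒↭ₛ (↭-sym (∈-perms⁻ n w∈))) (range1-unique n)

∈-perm⁺ : ∀ {n w v} → w ∈ perms n → v < n → suc v ∈ w
∈-perm⁺ {n} w∈ v<n = ∈-resp-↭ (↭-sym (∈-perms⁻ n w∈)) (∈-range1⁺ v<n)

∈-perm⁻ : ∀ {n w x} → w ∈ perms n → x ∈ w → ∃ λ v → v < n × x ≡ suc v
∈-perm⁻ {n} w∈ x∈ = ∈-range1⁻ {n} (∈-resp-↭ (∈-perms⁻ n w∈) x∈)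

sw-∈-range1 : ∀ {n v} → suc v < n → ∀ {x} → x ∈ range1 n → sw (suc v) x ∈ range1 n
sw-∈-range1 {n} {v} v<n x∈ with i , i<n , refl ← ∈-range1⁻ {n} x∈ with i ℕ.≟ v | i ℕ.≟ suc v
... | yes refl | _ rewrite sw-v v = ∈-range1⁺ v<n
... | no _ | yes refl rewrite sw-suc v = ∈-range1⁺ (ℕ.<-trans (ℕ.n<1+n v) v<n)
... | no p | no q rewrite sw-other p q = ∈-range1⁺ i<n

map-sw-∈-perms : ∀ {n v w} → suc v < n → w ∈ perms n → map (sw (suc v)) w ∈ perms n
map-sw-∈-perms {n} {v} {w} v<n w∈ = ∈-perms⁺ n
  (⊆∧length⇒↭ (Unique.map⁺ (sw-injective (suc v)) (Unique-perm {n} w∈)) sub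
    (ℕ.≤-reflexive (sym (trans (List.length-map _ w) (↭-length (∈-perms⁻ n w∈))))))
  where
  sub : ∀ {x} → x ∈ map (sw (suc v)) w → x ∈ range1 n
  sub x∈ with y , y∈ , refl ← ∈-map⁻ (sw (suc v)) x∈ = sw-∈-range1 {n} v<n (∈-resp-↭ (∈-perms⁻ n w∈) y∈)

-- Where `p` holds, the exchange keeps the ascents and flips the sign; elsewhere both terms are
-- zero. Values start at 1, hence `suc v`.
∑-nonadjacent : ∀ {n v} (p : List ℕ → Bool) k → suc v < n →
  (∀ w → p (map (sw (suc v)) w) ≡ p w) →
  (∀ {w} → w ∈ perms n → p w ≡ true → adjacent (suc v) w ≡ false) →
  ∑ (λ w → [ p w ]* χ k w) (perms n) ≡ 0ℤ
∑-nonadjacent {n} {v} p k v<n p-sw nadj =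
  ∑-sign-reversing (perms-unique n) (map-sw-∈-perms {n} v<n) (map-sw-involutive (suc v)) flip
  where
  neg-[]* : ∀ b z → [ b ]* - z ≡ - ([ b ]* z)
  neg-[]* true  z = refl
  neg-[]* false z = refl
  flip : ∀ {w} → w ∈ perms n → [ p (map (sw (suc v)) w) ]* χ k (map (sw (suc v)) w) ≡ - ([ p w ]* χ k w)
  flip {w} w∈ rewrite p-sw w with p w in eq
  ... | false = refl
  ... | true rewrite asc-sw (suc v) w (nadj w∈ eq)
        | sign-sw (suc v) w (Unique-perm {n} w∈) (∈-perm⁺ {n} w∈ (ℕ.<-trans (ℕ.n<1+n v) v<n)) (∈-perm⁺ {n} w∈ v<n)
        = neg-[]* (asc w ≡ᵇ k) (ε (inv w))

-- Parities of positions

≡ᵇ-refl : ∀ n → (n ≡ᵇ n) ≡ true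
≡ᵇ-refl zero    = refl
≡ᵇ-refl (suc n) = ≡ᵇ-refl n

≢⇒≡ᵇ-false : ∀ {m n} → m ≢ n → (m ≡ᵇ n) ≡ false
≢⇒≡ᵇ-false {zero}  {zero}  m≢n = contradiction refl m≢n
≢⇒≡ᵇ-false {zero}  {suc n} _   = refl
≢⇒≡ᵇ-false {suc m} {zero}  _   = refl
≢⇒≡ᵇ-false {suc m} {suc n} m≢n = ≢⇒≡ᵇ-false (m≢n ∘ cong suc)

-- The parity of the 0-based position of the first v in w (junk if v does not occur).
parity : ℕ → List ℕ → Bool
parity v []       = false
parity v (x ∷ xs) = if v ≡ᵇ x then false else not (parity v xs)

parity-here : ∀ {v x} xs → v ≡ x → parity v (x ∷ xs) ≡ false
parity-here {v} xs refl rewrite ≡ᵇ-refl v = refl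

parity-there : ∀ {v x} xs → v ≢ x → parity v (x ∷ xs) ≡ not (parity v xs)
parity-there xs v≢x rewrite ≢⇒≡ᵇ-false v≢x = refl

opposite : ℕ → List ℕ → Bool
opposite v w = parity v w xor parity (suc v) w

-- A filtration: `j` = 0 admits every word, and on permutations of [n] the value `j` = n - 1 will
-- turn out to be parity alternation.
alternating : ℕ → List ℕ → Bool
alternating zero    w = true
alternating (suc j) w = alternating j w ∧ opposite (suc j) w

-- The exchange moves no position: u now stands where `sw v u` stood.
parity-sw : ∀ v u w → parity u (map (sw v) w) ≡ parity (sw v u) w
parity-sw v u [] = refl
parity-sw v u (x ∷ xs) = cong₂ (λ b p → if b then false else not p) (shift-sw v u x) (parity-sw v u xs)
  where
  shift-sw : ∀ v u x → (u ≡ᵇ sw v x) ≡ (sw v u ≡ᵇ x)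
  shift-sw v u x with u ℕ.≟ sw v x
  ... | yes refl rewrite sw-involutive v x | ≡ᵇ-refl x = ≡ᵇ-refl (sw v x)
  ... | no u≢ = trans (≢⇒≡ᵇ-false u≢)
    (sym (≢⇒≡ᵇ-false λ eq → u≢ (trans (sym (sw-involutive v u)) (cong (sw v) eq))))

opposite-sw : ∀ v w → opposite v (map (sw v) w) ≡ opposite v w
opposite-sw v w rewrite parity-sw v v w | parity-sw v (suc v) w | sw-v v | sw-suc v =
  Bool.xor-comm (parity (suc v) w) (parity v w)

xor-false⇒≡ : ∀ a b → (a xor b) ≡ false → a ≡ b
xor-false⇒≡ true  true  _ = refl
xor-false⇒≡ false false _ = refl

-- Only v and v + 1 trade places, and their places have equal parity. Hence the exchange also
-- preserves the conditions on smaller values.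
parity-sw-same : ∀ v w → opposite v w ≡ false → ∀ u → parity u (map (sw v) w) ≡ parity u w
parity-sw-same v w same u = trans (parity-sw v u w) fixed
  where
  eq : parity v w ≡ parity (suc v) w
  eq = xor-false⇒≡ _ _ same
  fixed : parity (sw v u) w ≡ parity u w
  fixed with u ℕ.≟ v | u ℕ.≟ suc v
  ... | yes refl | _        rewrite sw-v v        = sym eq
  ... | no _     | yes refl rewrite sw-suc v      = eq
  ... | no u≢v   | no u≢sv  rewrite sw-other u≢v u≢sv = refl

alternating-cong : ∀ j {w w′} → (∀ u → parity u w ≡ parity u w′) → alternating j w ≡ alternating j w′
alternating-cong zero    eq = refl
alternating-cong (suc j) eq = cong₂ _∧_ (alternating-cong j eq) (cong₂ _xor_ (eq (suc j)) (eq (suc (suc j))))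

adjacent-∈ : ∀ v w → adjacent v w ≡ true → v ∈ w × suc v ∈ w
adjacent-∈ v (x ∷ y ∷ ys) adj with isPair v x y in eq | adjacent-∈ v (y ∷ ys)
... | false | rec = let p , q = rec adj in there p , there q
... | true  | _ with isPair⁻ v x y eq
...   | inj₁ (refl , refl) = here refl , there (here refl)
...   | inj₂ (refl , refl) = there (here refl) , here refl

-- Neighbouring positions differ by one; uniqueness ensures that `parity`, which reads first
-- occurrences, sees exactly these positions.
adjacent⇒opposite : ∀ v w → Unique w → adjacent v w ≡ true → opposite v w ≡ true
adjacent⇒opposite v (x ∷ y ∷ ys) (x∉ ∷ u) adj with isPair v x y in eq
... | true with isPair⁻ v x y eq
...   | inj₁ (refl , refl) rewrite ≡ᵇ-refl v | ≢⇒≡ᵇ-false (ℕ.1+n≢n {v}) = refl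
...   | inj₂ (refl , refl) rewrite ≡ᵇ-refl v | ≢⇒≡ᵇ-false (ℕ.1+n≢n {v} ∘ sym) = refl
adjacent⇒opposite v (x ∷ y ∷ ys) (x∉ ∷ u) adj | false
  with v∈ , sv∈ ← adjacent-∈ v (y ∷ ys) adj
  rewrite parity-there (y ∷ ys) (λ v≡x → All.lookup x∉ v∈ (sym v≡x))
        | parity-there (y ∷ ys) (λ sv≡x → All.lookup x∉ sv∈ (sym sv≡x))
  = trans (not-xor-not (parity v (y ∷ ys)) (parity (suc v) (y ∷ ys))) (adjacent⇒opposite v (y ∷ ys) u adj)
  where
  not-xor-not : ∀ a b → not a xor not b ≡ a xor b
  not-xor-not true  b = refl
  not-xor-not false b = Bool.not-involutive b

-- The permutations lost in this step are those whose first failure is at j + 1. The exchange of j +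
-- 1 and j + 2 maps them among themselves, and these values are not adjacent in them, so they
-- cancel.
∑-alternating-suc : ∀ {n j} k → suc j < n →
  ∑ (λ w → [ alternating j w ]* χ k w) (perms n) ≡ ∑ (λ w → [ alternating (suc j) w ]* χ k w) (perms n)
∑-alternating-suc {n} {j} k j<n = begin
  ∑ (λ w → [ alternating j w ]* χ k w) (perms n)
    ≡⟨ ∑-split (opposite (suc j)) _ (perms n) ⟩
  ∑ (λ w → [ opposite (suc j) w ]* [ alternating j w ]* χ k w) (perms n) +
  ∑ (λ w → [ not (opposite (suc j) w) ]* [ alternating j w ]* χ k w) (perms n)
    ≡⟨ cong₂ _+_ (∑-cong (perms n) λ {w} _ → nested (opposite (suc j) w) (alternating j w) _)
                 (∑-cong (perms n) λ {w} _ → nested (not (opposite (suc j) w)) (alternating j w) _) ⟩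
  ∑ (λ w → [ alternating (suc j) w ]* χ k w) (perms n) + ∑ (λ w → [ same w ]* χ k w) (perms n)
    ≡⟨ cong (λ z → ∑ (λ w → [ alternating (suc j) w ]* χ k w) (perms n) + z)
         (∑-nonadjacent {n} {j} same k j<n same-sw same⇒nonadjacent) ⟩
  ∑ (λ w → [ alternating (suc j) w ]* χ k w) (perms n) + 0ℤ
    ≡⟨ ℤ.+-identityʳ _ ⟩
  ∑ (λ w → [ alternating (suc j) w ]* χ k w) (perms n) ∎
  where
  open ≡-Reasoning
  nested : ∀ b c z → [ b ]* [ c ]* z ≡ [ c ∧ b ]* z
  nested true  true  z = refl
  nested true  false z = refl
  nested false true  z = refl
  nested false false z = refl
  same : List ℕ → Bool
  same w = alternating j w ∧ not (opposite (suc j) w)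
  same-sw : ∀ w → same (map (sw (suc j)) w) ≡ same w
  same-sw w rewrite opposite-sw (suc j) w with opposite (suc j) w in eq
  -- Equal parities at j + 1 and j + 2: the exchange changes no position parity, so the earlier
  -- conditions survive.
  ... | false = cong (_∧ true) (alternating-cong j (parity-sw-same (suc j) w eq))
  ... | true  = trans (Bool.∧-zeroʳ _) (sym (Bool.∧-zeroʳ _))
  same⇒nonadjacent : ∀ {w} → w ∈ perms n → same w ≡ true → adjacent (suc j) w ≡ false
  same⇒nonadjacent {w} w∈ s with adjacent (suc j) w in eq
  ... | false = refl
  ... | true rewrite adjacent⇒opposite (suc j) w (Unique-perm {n} w∈) eq =
    contradiction (trans (sym s) (Bool.∧-zeroʳ _)) λ ()

∑-alternating : ∀ n j k → j < n → ∑ (χ k) (perms n) ≡ ∑ (λ w → [ alternating j w ]* χ k w) (perms n)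
∑-alternating n zero    k _   = refl
∑-alternating n (suc j) k j<n =
  trans (∑-alternating n j k (ℕ.<-trans (ℕ.n<1+n j) j<n)) (∑-alternating-suc k j<n)

-- Parity alternation in terms of positions

isPAPB-∷ : ∀ x y ys → isPAPB (x ∷ y ∷ ys) ≡ (isEvenB x xor isEvenB y) ∧ isPAPB (y ∷ ys)
isPAPB-∷ x y ys with isEvenB x | isEvenB y
... | true  | true  = refl
... | true  | false = refl
... | false | true  = refl
... | false | false = refl

-- Value parities flip at each step, so an entry differs in parity from the first one exactly at the
-- odd positions, counted from 0.
isPAPB⇒parity : ∀ x xs → isPAPB (x ∷ xs) ≡ true → ∀ {v} → v ∈ x ∷ xs →
  parity v (x ∷ xs) ≡ isEvenB v xor isEvenB x
isPAPB⇒parity x xs pap (here refl) rewrite parity-here {x} xs refl = sym (Bool.xor-same (isEvenB x))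
isPAPB⇒parity x (y ∷ ys) pap {v} (there v∈) with v ℕ.≟ x
... | yes refl rewrite parity-here {x} (y ∷ ys) refl = sym (Bool.xor-same (isEvenB x))
... | no v≢x rewrite parity-there (y ∷ ys) v≢x | isPAPB-∷ x y ys
  | isPAPB⇒parity y ys (Bool.∧-conicalʳ _ (isPAPB (y ∷ ys)) pap) v∈ =
  flip-xor (isEvenB v) (isEvenB x) (isEvenB y) (Bool.∧-conicalˡ _ (isPAPB (y ∷ ys)) pap)
  where
  flip-xor : ∀ a b c → b xor c ≡ true → not (a xor c) ≡ a xor b
  flip-xor true  true  false _ = refl
  flip-xor true  false true  _ = refl
  flip-xor false true  false _ = refl
  flip-xor false false true  _ = refl

-- At position 0 the hypothesis makes `c` the evenness of the first entry; neighbours have opposite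
-- position parities, hence opposite value parities.
parity⇒isPAPB : ∀ c w → Unique w → (∀ {v} → v ∈ w → parity v w ≡ isEvenB v xor c) → isPAPB w ≡ true
parity⇒isPAPB c []           _ _ = refl
parity⇒isPAPB c (x ∷ [])     _ _ = refl
parity⇒isPAPB c (x ∷ y ∷ ys) (x∉ ∷ u) par rewrite isPAPB-∷ x y ys = cong₂ _∧_
  (head (isEvenB x) (isEvenB y) c
    (trans (sym (par (here refl))) (parity-here {x} (y ∷ ys) refl))
    (trans (sym (par (there (here refl))))
      (trans (parity-there (y ∷ ys) (All.lookup x∉ (here refl) ∘ sym)) (cong not (parity-here {y} ys refl)))))
  -- Positions in the tail are smaller by one, which flips the constant.
  (parity⇒isPAPB (not c) (y ∷ ys) u λ {v} v∈ → tail (isEvenB v) c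
    (trans (sym (parity-there (y ∷ ys) (All.lookup x∉ v∈ ∘ sym))) (par (there v∈))))
  where
  head : ∀ a b c → a xor c ≡ false → b xor c ≡ true → a xor b ≡ true
  head true  false true  _ _ = refl
  head false true  false _ _ = refl
  tail : ∀ {p} a c → not p ≡ a xor c → p ≡ a xor not c
  tail {true}  true  true  _ = refl
  tail {true}  false false _ = refl
  tail {false} true  false _ = refl
  tail {false} false true  _ = refl

-- The conditions telescope down to the value 1, whose position parity remains as the constant.
alternating⇒parity : ∀ j w → alternating j w ≡ true → ∀ i → i ≤ j →
  parity (suc i) w ≡ isEvenB (suc i) xor parity 1 w
alternating⇒parity j       w alt zero    _         = refl
alternating⇒parity (suc j) w alt (suc i) (s≤s i≤j) with i ℕ.≟ j
... | no i≢j = alternating⇒parity j w (Bool.∧-conicalˡ _ (opposite (suc j) w) alt) (suc i) (ℕ.≤∧≢⇒< i≤j i≢j)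
... | yes refl = step (isEvenB (suc i)) (parity 1 w)
    (alternating⇒parity j w (Bool.∧-conicalˡ _ (opposite (suc j) w) alt) i ℕ.≤-refl)
    (Bool.∧-conicalʳ (alternating j w) _ alt) (isEvenB-suc (suc i))
  where
  step : ∀ {p q e} a c → p ≡ a xor c → p xor q ≡ true → e ≡ not a → q ≡ e xor c
  step {q = true}  true  true  refl _ refl = refl
  step {q = false} true  false refl _ refl = refl
  step {q = false} false true  refl _ refl = refl
  step {q = true}  false false refl _ refl = refl

isPAPB⇒alternating : ∀ j x xs → isPAPB (x ∷ xs) ≡ true → (∀ i → i ≤ j → suc i ∈ x ∷ xs) →
  alternating j (x ∷ xs) ≡ true
isPAPB⇒alternating zero    x xs pap all∈ = refl
isPAPB⇒alternating (suc j) x xs pap all∈ = cong₂ _∧_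
  (isPAPB⇒alternating j x xs pap λ i i≤j → all∈ i (ℕ.m≤n⇒m≤1+n i≤j))
  (trans (cong₂ _xor_ (isPAPB⇒parity x xs pap (all∈ j (ℕ.n≤1+n j)))
                        (isPAPB⇒parity x xs pap (all∈ (suc j) ℕ.≤-refl)))
    (step (isEvenB (suc j)) (isEvenB x) (isEvenB-suc (suc j))))
  where
  step : ∀ {e} a b → e ≡ not a → (a xor b) xor (e xor b) ≡ true
  step true  true  refl = refl
  step true  false refl = refl
  step false true  refl = refl
  step false false refl = refl

-- Both sides say that position parity and value parity agree up to one constant for the whole word.
alternating≡isPAPB : ∀ {n w} → w ∈ perms (suc n) → alternating n w ≡ isPAPB w
alternating≡isPAPB {n} {[]} w∈ with ↭-length (∈-perms⁻ (suc n) w∈)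
... | ()
alternating≡isPAPB {n} {w@(x ∷ xs)} w∈ with alternating n w in alt | isPAPB w in pap
... | true  | true  = refl
... | false | false = refl
... | false | true  = contradiction
  (trans (sym alt) (isPAPB⇒alternating n x xs pap λ i i≤n → ∈-perm⁺ {suc n} w∈ (s≤s i≤n))) λ ()
-- The constant is `parity 1 w`: the first entry is even exactly when the odd value 1 stands at an
-- odd position.
... | true  | false = contradiction (trans (sym pap) (parity⇒isPAPB (parity 1 w) w (Unique-perm {suc n} w∈) par)) λ ()
  where
  par : ∀ {v} → v ∈ w → parity v w ≡ isEvenB v xor parity 1 w
  par v∈ with i , s≤s i≤n , refl ← ∈-perm⁻ {suc n} w∈ v∈ = alternating⇒parity n w alt i i≤n

R≡D : ∀ n k → R (suc n) k ≡ D (suc n) k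
R≡D n k = begin
  R (suc n) k                                              ≡⟨ R-∑ (suc n) k ⟩
  ∑ (λ w → [ isPAPB w ]* χ k w) (perms (suc n))
    ≡⟨ ∑-cong (perms (suc n)) (λ {w} w∈ → cong ([_]* χ k w) (sym (alternating≡isPAPB {n} w∈))) ⟩
  ∑ (λ w → [ alternating n w ]* χ k w) (perms (suc n))     ≡⟨ ∑-alternating (suc n) n k (ℕ.n<1+n n) ⟨
  ∑ (χ k) (perms (suc n))                                  ≡⟨ D-∑ (suc n) k ⟨
  D (suc n) k                                              ∎
  where open ≡-Reasoning

-- Permutations with adjacent top values as block insertions

concatMap-unique : ∀ {A X : Set} {g : A → List X} {as} → Unique as → (∀ {a} → a ∈ as → Unique (g a)) →
  (∀ {a b x} → a ∈ as → b ∈ as → x ∈ g a → x ∈ g b → a ≡ b) → Unique (concatMap g as)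
concatMap-unique []       _  _   = []
concatMap-unique {g = g} {a ∷ as} (a∉ ∷ u) ug key = Unique.++⁺ (ug (here refl))
  (concatMap-unique u (ug ∘ there) λ p q → key (there p) (there q))
  λ { (x∈a , x∈) → let b , b∈ , x∈b = find (∈-concatMap⁻ g x∈) in
      All.lookup a∉ b∈ (key (here refl) (there b∈) x∈a x∈b) }

blockInsertions : ℕ → ℕ → List ℕ → List (List ℕ)
blockInsertions x y []      = (x ∷ y ∷ []) ∷ []
blockInsertions x y (z ∷ u) = (x ∷ y ∷ z ∷ u) ∷ map (z ∷_) (blockInsertions x y u)

∈-blockInsertions⁺ : ∀ {x y} p q → p ++ x ∷ y ∷ q ∈ blockInsertions x y (p ++ q)
∈-blockInsertions⁺ []      []      = here refl
∈-blockInsertions⁺ []      (z ∷ q) = here refl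
∈-blockInsertions⁺ (z ∷ p) q       = there (∈-map⁺ (z ∷_) (∈-blockInsertions⁺ p q))

∈-blockInsertions⁻ : ∀ {x y} u {w} → w ∈ blockInsertions x y u →
  ∃₂ λ p q → u ≡ p ++ q × w ≡ p ++ x ∷ y ∷ q
∈-blockInsertions⁻ []      (here refl) = [] , [] , refl , refl
∈-blockInsertions⁻ (z ∷ u) (here refl) = [] , z ∷ u , refl , refl
∈-blockInsertions⁻ (z ∷ u) (there w∈) with v , v∈ , refl ← ∈-map⁻ (z ∷_) w∈
  with p , q , refl , refl ← ∈-blockInsertions⁻ u v∈ = z ∷ p , q , refl , refl

-- The front insertion starts with x, all others with an entry of u, which is not x.
blockInsertions-unique : ∀ {x y} u → x ∉ u → Unique (blockInsertions x y u)
blockInsertions-unique []      _  = [] ∷ []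
blockInsertions-unique (z ∷ u) x∉ =
  All.tabulate (λ v∈ eq → let _ , _ , eq′ = ∈-map⁻ (z ∷_) v∈ in x∉ (here (List.∷-injectiveˡ (trans eq eq′))))
  ∷ Unique.map⁺ List.∷-injectiveʳ (blockInsertions-unique u (x∉ ∘ there))

adjacent-∷ : ∀ v z w → adjacent v w ≡ true → adjacent v (z ∷ w) ≡ true
adjacent-∷ v z (x ∷ w) adj rewrite adj = Bool.∨-zeroʳ (isPair v z x)

adjacent⁺ : ∀ v {x y} p q → isPair v x y ≡ true → adjacent v (p ++ x ∷ y ∷ q) ≡ true
adjacent⁺ v []      q pair rewrite pair = refl
adjacent⁺ v (z ∷ p) q pair = adjacent-∷ v z (p ++ _) (adjacent⁺ v p q pair)

adjacent⁻ : ∀ v w → adjacent v w ≡ true →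
  ∃₂ λ x y → ∃₂ λ p q → isPair v x y ≡ true × w ≡ p ++ x ∷ y ∷ q
adjacent⁻ v (x ∷ y ∷ w) adj with isPair v x y in eq | adjacent⁻ v (y ∷ w)
... | true  | _   = x , y , [] , w , eq , refl
... | false | rec with x′ , y′ , p , q , pair , eq′ ← rec adj = x′ , y′ , x ∷ p , q , pair , cong (x ∷_) eq′

-- The two orders in which the largest values of [m + 2] can be adjacent.
topPairs : ℕ → List (ℕ × ℕ)
topPairs m = (suc m , suc (suc m)) ∷ (suc (suc m) , suc m) ∷ []

∈-topPairs⁺ : ∀ {m x y} → isPair (suc m) x y ≡ true → (x , y) ∈ topPairs m
∈-topPairs⁺ {m} {x} {y} pair with isPair⁻ (suc m) x y pair
... | inj₁ (refl , refl) = here refl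
... | inj₂ (refl , refl) = there (here refl)

∈-topPairs⁻ : ∀ {m x y} → (x , y) ∈ topPairs m →
  isPair (suc m) x y ≡ true × m < x × m < y × x ∷ y ∷ range1 m ↭ range1 (suc (suc m))
∈-topPairs⁻ {m} (here refl) = isPair-v m , ℕ.n<1+n m , ℕ.m<n⇒m<1+n (ℕ.n<1+n m) ,
  ↭-sym (↭-trans (range1-suc (suc m)) (↭-trans (prep _ (range1-suc m)) (swap _ _ refl)))
∈-topPairs⁻ {m} (there (here refl)) = isPair-suc m , ℕ.m<n⇒m<1+n (ℕ.n<1+n m) , ℕ.n<1+n m ,
  ↭-sym (↭-trans (range1-suc (suc m)) (prep _ (range1-suc m)))

insertTop : (ℕ × ℕ) × List ℕ → List (List ℕ)
insertTop ((x , y) , u) = blockInsertions x y u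

small : ∀ {m u} → u ∈ perms m → All (_≤ m) u
small {m} u∈ = All.tabulate bound
  where
  bound : ∀ {x} → x ∈ _ → x ≤ m
  bound x∈ with _ , i<m , refl ← ∈-perm⁻ {m} u∈ x∈ = i<m

module _ (m : ℕ) where

  private
    indices = cartesianProduct (topPairs m) (perms m)

  indices-unique : Unique indices
  indices-unique = Unique.cartesianProduct⁺ (((λ ()) ∷ []) ∷ [] ∷ []) (perms-unique m)

  -- A word remembers its index: the entries above m spell the block and the others spell u.
  -- Insertions for distinct indices are therefore disjoint.
  index-determined : ∀ {i w} → i ∈ indices → w ∈ insertTop i →
    filter (m ℕ.<?_) w ≡ proj₁ (proj₁ i) ∷ proj₂ (proj₁ i) ∷ [] × filter (ℕ._≤? m) w ≡ proj₂ i
  index-determined {(x , y) , u} i∈ w∈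
    with xy∈ , u∈ ← ∈-cartesianProduct⁻ (topPairs m) (perms m) i∈
    with _ , m<x , m<y , _ ← ∈-topPairs⁻ xy∈
    with p , q , refl , refl ← ∈-blockInsertions⁻ u w∈
    rewrite List.filter-++ (m ℕ.<?_) p (x ∷ y ∷ q) | List.filter-++ (ℕ._≤? m) p (x ∷ y ∷ q)
    | List.filter-none (m ℕ.<?_) (All.map ℕ.≤⇒≯ (All.++⁻ˡ p (small {m} u∈)))
    | List.filter-accept (m ℕ.<?_) {xs = y ∷ q} m<x | List.filter-accept (m ℕ.<?_) {xs = q} m<y
    | List.filter-none (m ℕ.<?_) (All.map ℕ.≤⇒≯ (All.++⁻ʳ p (small {m} u∈)))
    | List.filter-reject (ℕ._≤? m) {xs = y ∷ q} (ℕ.<⇒≱ m<x) | List.filter-reject (ℕ._≤? m) {xs = q} (ℕ.<⇒≱ m<y)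
    | List.filter-all (ℕ._≤? m) (All.++⁻ˡ p (small {m} u∈)) | List.filter-all (ℕ._≤? m) (All.++⁻ʳ p (small {m} u∈))
    = refl , refl

  insertTop-unique : Unique (concatMap insertTop indices)
  insertTop-unique = concatMap-unique indices-unique each distinct
    where
    each : ∀ {i} → i ∈ indices → Unique (insertTop i)
    each {(x , y) , u} i∈ with xy∈ , u∈ ← ∈-cartesianProduct⁻ (topPairs m) (perms m) i∈
      with _ , m<x , _ ← ∈-topPairs⁻ xy∈ =
      blockInsertions-unique u λ x∈ → ℕ.<⇒≱ m<x (All.lookup (small {m} u∈) x∈)
    distinct : ∀ {i j w} → i ∈ indices → j ∈ indices → w ∈ insertTop i → w ∈ insertTop j → i ≡ j
    distinct i∈ j∈ wi wj with a , b ← index-determined i∈ wi with c , d ← index-determined j∈ wj =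
      cong₂ _,_ (cong₂ _,_ (List.∷-injectiveˡ (trans (sym a) c))
                           (List.∷-injectiveˡ (List.∷-injectiveʳ (trans (sym a) c))))
                (trans (sym b) d)

  -- Neither list has repetitions, so it suffices to compare elements: cutting the block out leaves
  -- a permutation of [m], and inserting it is the inverse.
  adjacent-perms : filterᵇ (adjacent (suc m)) (perms (suc (suc m))) ↭ concatMap insertTop indices
  adjacent-perms =
    ∼bag⇒↭ (unique∧set⇒bag (Unique.filter⁺ _ (perms-unique n)) insertTop-unique (mk⇔ to from))
    where
    n = suc (suc m)
    to : ∀ {w} → w ∈ filterᵇ (adjacent (suc m)) (perms n) → w ∈ concatMap insertTop indices
    to {w} w∈ with w∈perms , adj ← ∈-filter⁻ (Bool.T? ∘ adjacent (suc m)) {xs = perms n} w∈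
      with x , y , p , q , pair , refl ← adjacent⁻ (suc m) w (Equivalence.to Bool.T-≡ adj)
      with _ , _ , _ , top ← ∈-topPairs⁻ (∈-topPairs⁺ pair) =
      ∈-concatMap⁺ insertTop (lose (∈-cartesianProduct⁺ (∈-topPairs⁺ pair) (∈-perms⁺ m
        -- The block is moved to the front of both rearrangements and cancelled there.
        (↭.drop-∷ (↭.drop-∷ (↭-trans (↭-sym (↭.shifts p (x ∷ y ∷ []))) (↭-trans (∈-perms⁻ n w∈perms) (↭-sym top)))))))
        (∈-blockInsertions⁺ p q))
    from : ∀ {w} → w ∈ concatMap insertTop indices → w ∈ filterᵇ (adjacent (suc m)) (perms n)
    from w∈ with ((x , y) , u) , i∈ , w∈i ← find (∈-concatMap⁻ insertTop w∈)
      with xy∈ , u∈ ← ∈-cartesianProduct⁻ (topPairs m) (perms m) i∈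
      with pair , _ , _ , top ← ∈-topPairs⁻ xy∈
      with p , q , refl , refl ← ∈-blockInsertions⁻ u w∈i =
      ∈-filter⁺ (Bool.T? ∘ adjacent (suc m))
        (∈-perms⁺ n (↭-trans (↭.shifts p (x ∷ y ∷ [])) (↭-trans (prep x (prep y (∈-perms⁻ m u∈))) top)))
        (Equivalence.from Bool.T-≡ (adjacent⁺ (suc m) p q pair))

-- Signs and ascents under block insertion

<⇒<ᵇ-true : ∀ {m n} → m < n → (m <ᵇ n) ≡ true
<⇒<ᵇ-true m<n = Equivalence.to Bool.T-≡ (ℕ.<⇒<ᵇ m<n)

<⇒<ᵇ-false : ∀ {m n} → m < n → (n <ᵇ m) ≡ false
<⇒<ᵇ-false {m} {n} m<n with n <ᵇ m in eq
... | false = refl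
... | true  = contradiction (ℕ.<ᵇ⇒< n m (Equivalence.from Bool.T-≡ eq)) (ℕ.<-asym m<n)

𝟙 : Bool → ℕ
𝟙 b = if b then 1 else 0

cnt-all : ∀ {x} u → All (_< x) u → cnt x u ≡ length u
cnt-all []      []         = refl
cnt-all (z ∷ u) (z<x ∷ ps) rewrite <⇒<ᵇ-true z<x = cong suc (cnt-all u ps)

cnt-blockInsertions : ∀ {x y z} u {w} → z < x → z < y → w ∈ blockInsertions x y u → cnt z w ≡ cnt z u
cnt-blockInsertions []      z<x z<y (here refl) rewrite <⇒<ᵇ-false z<x | <⇒<ᵇ-false z<y = refl
cnt-blockInsertions (a ∷ u) z<x z<y (here refl) rewrite <⇒<ᵇ-false z<x | <⇒<ᵇ-false z<y = refl
cnt-blockInsertions {z = z} (a ∷ u) z<x z<y (there w∈) with v , v∈ , refl ← ∈-map⁻ (a ∷_) w∈ =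
  cong (𝟙 (a <ᵇ z) ℕ.+_) (cnt-blockInsertions u z<x z<y v∈)

-- Each of x and y exceeds all of u; these inversions number twice the length of u and leave the
-- sign alone.
sign-block : ∀ {x y} u → All (_< x) u → All (_< y) u →
  ε (inv (x ∷ y ∷ u)) ≡ ε (𝟙 (y <ᵇ x)) * ε (inv u)
sign-block {x} {y} u <x <y rewrite inv-∷ x (y ∷ u) | inv-∷ y u | cnt-all u <x | cnt-all u <y = begin
  ε (i ℕ.+ l ℕ.+ (l ℕ.+ inv u))      ≡⟨ cong ε (trans (ℕ.+-assoc i l _) (cong (i ℕ.+_) (sym (ℕ.+-assoc l l _)))) ⟩
  ε (i ℕ.+ (l ℕ.+ l ℕ.+ inv u))      ≡⟨ ε-+ i _ ⟩
  ε i * ε (l ℕ.+ l ℕ.+ inv u)        ≡⟨ cong (ε i *_) (ε-+ (l ℕ.+ l) (inv u)) ⟩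
  ε i * (ε (l ℕ.+ l) * ε (inv u))    ≡⟨ cong (λ s → ε i * (s * ε (inv u))) (ε-double l) ⟩
  ε i * (1ℤ * ε (inv u))             ≡⟨ cong (ε i *_) (ℤ.*-identityˡ _) ⟩
  ε i * ε (inv u)                    ∎
  where
  open ≡-Reasoning
  i = 𝟙 (y <ᵇ x)
  l = length u

-- An entry before the block forms no inversion with it and an entry behind it forms two, so every
-- gap gives the same sign.
sign-blockInsertions : ∀ {x y} u {w} → All (_< x) u → All (_< y) u → w ∈ blockInsertions x y u →
  ε (inv w) ≡ ε (𝟙 (y <ᵇ x)) * ε (inv u)
sign-blockInsertions {x} {y} [] <x <y (here refl) = sign-block {x} {y} [] [] []
sign-blockInsertions (z ∷ u) <x <y (here refl) = sign-block (z ∷ u) <x <y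
sign-blockInsertions {x} {y} (z ∷ u) (z<x ∷ <x) (z<y ∷ <y) (there w∈)
  with v , v∈ , refl ← ∈-map⁻ (z ∷_) w∈
  rewrite inv-∷ z v | inv-∷ z u | cnt-blockInsertions u z<x z<y v∈ | ε-+ (cnt z u) (inv v)
  | ε-+ (cnt z u) (inv u) | sign-blockInsertions u <x <y v∈ =
  exchange (ε (cnt z u)) (ε (𝟙 (y <ᵇ x))) (ε (inv u))
  where
  exchange : ∀ a b c → a * (b * c) ≡ b * (a * c)
  exchange = solve-∀

-- The gaps behind `z`, without the front one. Besides its own, a block inside an ascent destroys
-- one ascent and creates one; in a descent or at the end it only creates one.
∑-asc-blockInsertions-∷ : ∀ {x y} (φ : ℕ → ℤ) z u → All (_< x) (z ∷ u) → All (_< y) (z ∷ u) →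
  let a = asc (z ∷ u); s = 𝟙 (x <ᵇ y) in
  ∑ (λ w → φ (asc (z ∷ w))) (blockInsertions x y u) ≡
  + a * φ (a ℕ.+ s) + (+ length (z ∷ u) - + a) * φ (suc (a ℕ.+ s))
∑-asc-blockInsertions-∷ {x} {y} φ z [] (z<x ∷ _) _
  rewrite <⇒<ᵇ-true z<x | ℕ.+-identityʳ (𝟙 (x <ᵇ y)) = base (φ (𝟙 (x <ᵇ y))) (φ (suc (𝟙 (x <ᵇ y))))
  where
  base : ∀ f g → g + 0ℤ ≡ 0ℤ * f + (1ℤ - 0ℤ) * g
  base = solve-∀
∑-asc-blockInsertions-∷ {x} {y} φ z (z′ ∷ u) (z<x ∷ <x@(z′<x ∷ _)) (_ ∷ <y@(z′<y ∷ _))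
  rewrite ∑-map (λ w → φ (asc (z ∷ w))) (z′ ∷_) (blockInsertions x y u)
  -- Insertions behind `z′` leave the step from `z` to `z′` intact. The induction hypothesis absorbs
  -- its possible ascent into the weight, which is why `φ` is arbitrary.
  | ∑-asc-blockInsertions-∷ (λ j → φ (𝟙 (z <ᵇ z′) ℕ.+ j)) z′ u <x <y
  | <⇒<ᵇ-true z<x | <⇒<ᵇ-false z′<y
  | ℕ.+-comm (𝟙 (x <ᵇ y)) (asc (z′ ∷ u)) with z <ᵇ z′
... | true  = step (+ asc (z′ ∷ u)) (+ length u)
    (φ (suc (asc (z′ ∷ u) ℕ.+ 𝟙 (x <ᵇ y)))) (φ (suc (suc (asc (z′ ∷ u) ℕ.+ 𝟙 (x <ᵇ y)))))
  where
  step : ∀ a l f g → f + (a * f + (1ℤ + l - a) * g) ≡ (1ℤ + a) * f + (1ℤ + (1ℤ + l) - (1ℤ + a)) * g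
  step = solve-∀
... | false = step (+ asc (z′ ∷ u)) (+ length u)
    (φ (asc (z′ ∷ u) ℕ.+ 𝟙 (x <ᵇ y))) (φ (suc (asc (z′ ∷ u) ℕ.+ 𝟙 (x <ᵇ y))))
  where
  step : ∀ a l f g → g + (a * f + (1ℤ + l - a) * g) ≡ a * f + (1ℤ + (1ℤ + l) - a) * g
  step = solve-∀

-- A block of two maxima creates no ascent beyond its own when put in front or inside an
-- ascent of u (1 + asc u gaps), and one more in each of the other gaps.
∑-asc-blockInsertions : ∀ {x y} (φ : ℕ → ℤ) u → All (_< x) u → All (_< y) u →
  let a = asc u; s = 𝟙 (x <ᵇ y) in
  ∑ (φ ∘ asc) (blockInsertions x y u) ≡
  (1ℤ + + a) * φ (a ℕ.+ s) + (+ length u - + a) * φ (suc (a ℕ.+ s))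
∑-asc-blockInsertions {x} {y} φ [] _ _ rewrite ℕ.+-identityʳ (𝟙 (x <ᵇ y)) = base (φ (𝟙 (x <ᵇ y))) (φ (suc (𝟙 (x <ᵇ y))))
  where
  base : ∀ f g → f + 0ℤ ≡ (1ℤ + 0ℤ) * f + (0ℤ - 0ℤ) * g
  base = solve-∀
∑-asc-blockInsertions {x} {y} φ (z ∷ u) <x <y@(z<y ∷ _)
  rewrite ∑-map (φ ∘ asc) (z ∷_) (blockInsertions x y u) | ∑-asc-blockInsertions-∷ φ z u <x <y
  | <⇒<ᵇ-false z<y | ℕ.+-comm (𝟙 (x <ᵇ y)) (asc (z ∷ u)) =
  step (+ asc (z ∷ u)) (+ length u) (φ (asc (z ∷ u) ℕ.+ 𝟙 (x <ᵇ y))) (φ (suc (asc (z ∷ u) ℕ.+ 𝟙 (x <ᵇ y))))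
  where
  step : ∀ a l f g → f + (a * f + (1ℤ + l - a) * g) ≡ (1ℤ + a) * f + (1ℤ + l - a) * g
  step = solve-∀

-- The Eulerian operator on coefficient sequences

-- A coefficient sequence d stands for the polynomial Σ dₖ tᵏ; shift, Δ and euler N are then
-- p ↦ t p, p ↦ (t - 1) p and p ↦ (1 + (N - 1) t) p + t (1 - t) p′.
shift : (ℕ → ℤ) → ℕ → ℤ
shift d zero    = 0ℤ
shift d (suc k) = d k

Δ : (ℕ → ℤ) → ℕ → ℤ
Δ d k = shift d k - d k

euler : ℕ → (ℕ → ℤ) → ℕ → ℤ
euler N d k = (+ N - + k) * shift d k + (+ k + 1ℤ) * d k

shift-cong : ∀ {d e} → (∀ k → d k ≡ e k) → ∀ k → shift d k ≡ shift e k
shift-cong d≗e zero    = refl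
shift-cong d≗e (suc k) = d≗e k

Δ-cong : ∀ {d e} → (∀ k → d k ≡ e k) → ∀ k → Δ d k ≡ Δ e k
Δ-cong d≗e k = cong₂ _-_ (shift-cong d≗e k) (d≗e k)

euler-cong : ∀ N {d e} → (∀ k → d k ≡ e k) → ∀ k → euler N d k ≡ euler N e k
euler-cong N d≗e k = cong₂ (λ a b → (+ N - + k) * a + (+ k + 1ℤ) * b) (shift-cong d≗e k) (d≗e k)

-- Product rule: differentiating the factor t - 1 contributes t (1 - t) p = - t (t - 1) p, which
-- offsets the increase of N by one.
euler-Δ : ∀ N d k → euler (suc N) (Δ d) k ≡ Δ (euler N d) k
euler-Δ N d zero = lemma (+ N) (d 0)
  where
  lemma : ∀ n a → (1ℤ + n - 0ℤ) * 0ℤ + (0ℤ + 1ℤ) * (0ℤ - a) ≡ 0ℤ - ((n - 0ℤ) * 0ℤ + (0ℤ + 1ℤ) * a)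
  lemma = solve-∀
euler-Δ N d (suc k) = lemma (+ N) (+ k) (shift d k) (d k) (d (suc k))
  where
  lemma : ∀ n k a b c → (1ℤ + n - (1ℤ + k)) * (a - b) + (1ℤ + k + 1ℤ) * (b - c) ≡
    ((n - k) * a + (k + 1ℤ) * b) - ((n - (1ℤ + k)) * b + (1ℤ + k + 1ℤ) * c)
  lemma = solve-∀

∑-shift : ∀ {A : Set} (f : A → ℕ → ℤ) xs k → ∑ (λ x → shift (f x) k) xs ≡ shift (λ j → ∑ (λ x → f x j) xs) k
∑-shift f xs (suc k) = refl
∑-shift f []       zero = refl
∑-shift f (x ∷ xs) zero = trans (ℤ.+-identityˡ _) (∑-shift f xs zero)

∑-Δ : ∀ {A : Set} (f : A → ℕ → ℤ) xs k → ∑ (λ x → Δ (f x) k) xs ≡ Δ (λ j → ∑ (λ x → f x j) xs) k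
∑-Δ f xs k = begin
  ∑ (λ x → Δ (f x) k) xs
    ≡⟨ ∑-+ (λ x → shift (f x) k) (λ x → - f x k) xs ⟩
  ∑ (λ x → shift (f x) k) xs + ∑ (λ x → - f x k) xs
    ≡⟨ cong₂ _+_ (∑-shift f xs k) (∑-cong xs λ {x} _ → sym (ℤ.-1*i≡-i (f x k))) ⟩
  shift (λ j → ∑ (λ x → f x j) xs) k + ∑ (λ x → - 1ℤ * f x k) xs
    ≡⟨ cong (λ z → shift (λ j → ∑ (λ x → f x j) xs) k + z) (trans (∑-* (- 1ℤ) (λ x → f x k) xs) (ℤ.-1*i≡-i _)) ⟩
  Δ (λ j → ∑ (λ x → f x j) xs) k ∎
  where open ≡-Reasoning

∑-euler : ∀ {A : Set} N (f : A → ℕ → ℤ) xs k → ∑ (λ x → euler N (f x) k) xs ≡ euler N (λ j → ∑ (λ x → f x j) xs) k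
∑-euler N f xs k = begin
  ∑ (λ x → euler N (f x) k) xs
    ≡⟨ ∑-+ (λ x → (+ N - + k) * shift (f x) k) (λ x → (+ k + 1ℤ) * f x k) xs ⟩
  ∑ (λ x → (+ N - + k) * shift (f x) k) xs + ∑ (λ x → (+ k + 1ℤ) * f x k) xs
    ≡⟨ cong₂ _+_ (∑-* (+ N - + k) (λ x → shift (f x) k) xs) (∑-* (+ k + 1ℤ) (λ x → f x k) xs) ⟩
  (+ N - + k) * ∑ (λ x → shift (f x) k) xs + (+ k + 1ℤ) * ∑ (λ x → f x k) xs
    ≡⟨ cong (λ z → (+ N - + k) * z + (+ k + 1ℤ) * ∑ (λ x → f x k) xs) (∑-shift f xs k) ⟩
  euler N (λ j → ∑ (λ x → f x j) xs) k ∎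
  where open ≡-Reasoning

[]*-1 : ∀ b z → [ b ]* z ≡ z * ([ b ]* 1ℤ)
[]*-1 true  z = sym (ℤ.*-identityʳ z)
[]*-1 false z = sym (ℤ.*-zeroʳ z)

δ : ℕ → ℕ → ℤ
δ k j = [ j ≡ᵇ k ]* 1ℤ

-- Since `δ k j` vanishes off the diagonal, weights depending on the number of ascents may be
-- written in terms of the target degree k.
δ-subst : ∀ (g : ℕ → ℤ) k j → g j * δ k j ≡ g k * δ k j
δ-subst g k j with j ≡ᵇ k in eq
... | true  = cong (λ z → g z * 1ℤ) (ℕ.≡ᵇ⇒≡ j k (Equivalence.from Bool.T-≡ eq))
... | false = trans (ℤ.*-zeroʳ (g j)) (sym (ℤ.*-zeroʳ (g k)))

-- Here N is `length u` + 1. Degree k is reached from `asc u` = k with weight k + 1, and from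
-- `asc u` = k - 1 with weight `length u` - (k - 1) = N - k.
insertion-euler : ∀ u k →
  ε (inv u) * ((1ℤ + + asc u) * δ k (asc u) + (+ length u - + asc u) * δ k (suc (asc u)))
  ≡ euler (suc (length u)) (λ j → χ j u) k
insertion-euler u zero rewrite []*-1 (asc u ≡ᵇ 0) (ε (inv u)) | δ-subst (λ j → 1ℤ + + j) 0 (asc u) =
  lemma (ε (inv u)) (δ 0 (asc u)) (+ length u) (+ asc u)
  where
  lemma : ∀ e x l a → e * (1ℤ * x + (l - a) * 0ℤ) ≡ (1ℤ + l - 0ℤ) * 0ℤ + (0ℤ + 1ℤ) * (e * x)
  lemma = solve-∀
insertion-euler u (suc k)
  rewrite []*-1 (asc u ≡ᵇ k) (ε (inv u)) | []*-1 (asc u ≡ᵇ suc k) (ε (inv u))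
  | δ-subst (λ j → 1ℤ + + j) (suc k) (asc u) | δ-subst (λ j → + length u - + j) k (asc u) =
  lemma (ε (inv u)) (δ (suc k) (asc u)) (δ k (asc u)) (+ length u) (+ k)
  where
  lemma : ∀ e x y l k → e * ((1ℤ + (1ℤ + k)) * x + (l - k) * y) ≡
    (1ℤ + l - (1ℤ + k)) * (e * y) + (1ℤ + k + 1ℤ) * (e * x)
  lemma = solve-∀

∑-χ-blockInsertions : ∀ {x y} k u → All (_< x) u → All (_< y) u →
  let a = asc u; s = 𝟙 (x <ᵇ y) in
  ∑ (χ k) (blockInsertions x y u) ≡ ε (𝟙 (y <ᵇ x)) * (ε (inv u) *
    ((1ℤ + + a) * δ k (a ℕ.+ s) + (+ length u - + a) * δ k (suc (a ℕ.+ s))))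
∑-χ-blockInsertions {x} {y} k u <x <y = begin
  ∑ (χ k) (blockInsertions x y u)
    ≡⟨ ∑-cong (blockInsertions x y u) (λ {w} w∈ → trans ([]*-1 (asc w ≡ᵇ k) (ε (inv w)))
         (cong (_* δ k (asc w)) (sign-blockInsertions u <x <y w∈))) ⟩
  ∑ (λ w → i * ε (inv u) * δ k (asc w)) (blockInsertions x y u)
    ≡⟨ ∑-* (i * ε (inv u)) (δ k ∘ asc) (blockInsertions x y u) ⟩
  i * ε (inv u) * ∑ (δ k ∘ asc) (blockInsertions x y u)
    ≡⟨ cong (λ z → i * ε (inv u) * z) (∑-asc-blockInsertions (δ k) u <x <y) ⟩
  i * ε (inv u) * _
    ≡⟨ ℤ.*-assoc i (ε (inv u)) _ ⟩
  i * (ε (inv u) * _) ∎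
  where
  open ≡-Reasoning
  i = ε (𝟙 (y <ᵇ x))

small< : ∀ {m u} → u ∈ perms m → All (_< suc m) u × All (_< suc (suc m)) u
small< {m} u∈ = All.map s≤s (small {m} u∈) , All.map (ℕ.m<n⇒m<1+n ∘ s≤s) (small {m} u∈)

length-perm : ∀ {m u} → u ∈ perms m → length u ≡ m
length-perm {m} u∈ = trans (↭-length (∈-perms⁻ m u∈)) (length-range1 m)

-- The block brings its own ascent, hence the shift in degree, and no inner inversion.
∑-ascending-block : ∀ {m u} k → u ∈ perms m →
  ∑ (χ k) (blockInsertions (suc m) (suc (suc m)) u) ≡ shift (euler (suc m) (λ j → χ j u)) k
∑-ascending-block {m} {u} k u∈ with <x , <y ← small< {m} u∈
  rewrite ∑-χ-blockInsertions k u <x <y | n<ᵇ1+n m | 1+n≮ᵇn m | ℕ.+-comm (asc u) 1 = trans (ℤ.*-identityˡ _) (case k)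
  where
  case : ∀ k → ε (inv u) * ((1ℤ + + asc u) * δ k (suc (asc u)) + (+ length u - + asc u) * δ k (suc (suc (asc u))))
    ≡ shift (euler (suc m) (λ j → χ j u)) k
  case zero    = lemma (ε (inv u)) (1ℤ + + asc u) (+ length u - + asc u)
    where
    lemma : ∀ a b c → a * (b * 0ℤ + c * 0ℤ) ≡ 0ℤ
    lemma = solve-∀
  case (suc k) rewrite sym (length-perm {m} u∈) = insertion-euler u k

-- The block brings no ascent and one inner inversion, hence the minus sign. Together with the
-- ascending block this produces `Δ`.
∑-descending-block : ∀ {m u} k → u ∈ perms m →
  ∑ (χ k) (blockInsertions (suc (suc m)) (suc m) u) ≡ - euler (suc m) (λ j → χ j u) k
∑-descending-block {m} {u} k u∈ with <x , <y ← small< {m} u∈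
  rewrite ∑-χ-blockInsertions k u <y <x | n<ᵇ1+n m | 1+n≮ᵇn m | ℕ.+-identityʳ (asc u) =
  trans (ℤ.-1*i≡-i _) (cong -_ (trans (insertion-euler u k)
    (cong (λ l → euler (suc l) (λ j → χ j u) k) (length-perm {m} u∈))))

∑-adjacent-top : ∀ m k → ∑ (χ k) (concatMap insertTop (cartesianProduct (topPairs m) (perms m)))
  ≡ Δ (euler (suc m) (λ j → ∑ (χ j) (perms m))) k
∑-adjacent-top m k = begin
  ∑ (χ k) (concatMap insertTop (cartesianProduct (topPairs m) (perms m)))
    ≡⟨ ∑-concatMap (χ k) insertTop (cartesianProduct (topPairs m) (perms m)) ⟩
  ∑ F (map (up ,_) (perms m) ++ map (down ,_) (perms m) ++ [])
    ≡⟨ cong (λ z → ∑ F (map (up ,_) (perms m) ++ z)) (List.++-identityʳ _) ⟩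
  ∑ F (map (up ,_) (perms m) ++ map (down ,_) (perms m))
    ≡⟨ ∑-++ F (map (up ,_) (perms m)) _ ⟩
  ∑ F (map (up ,_) (perms m)) + ∑ F (map (down ,_) (perms m))
    ≡⟨ cong₂ _+_ (trans (∑-map F (up ,_) (perms m)) (∑-cong (perms m) (∑-ascending-block k)))
                 (trans (∑-map F (down ,_) (perms m)) (∑-cong (perms m) (∑-descending-block k))) ⟩
  ∑ (λ u → shift (E u) k) (perms m) + ∑ (λ u → - E u k) (perms m)
    ≡⟨ ∑-+ (λ u → shift (E u) k) (λ u → - E u k) (perms m) ⟨
  ∑ (λ u → Δ (E u) k) (perms m)
    ≡⟨ ∑-Δ E (perms m) k ⟩
  Δ (λ j → ∑ (λ u → E u j) (perms m)) k
    ≡⟨ Δ-cong (∑-euler (suc m) (λ u j → χ j u) (perms m)) k ⟩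
  Δ (euler (suc m) (λ j → ∑ (χ j) (perms m))) k ∎
  where
  open ≡-Reasoning
  up down : ℕ × ℕ
  up   = suc m , suc (suc m)
  down = suc (suc m) , suc m
  F : (ℕ × ℕ) × List ℕ → ℤ
  F i = ∑ (χ k) (insertTop i)
  E : List ℕ → ℕ → ℤ
  E u = euler (suc m) (λ j → χ j u)

-- Recurrences for the signed Eulerian numbers

D-two-step : ∀ m k → D (suc (suc m)) k ≡ Δ (euler (suc m) (D m)) k
D-two-step m k = begin
  D n k                                          ≡⟨ D-∑ n k ⟩
  ∑ (χ k) (perms n)                              ≡⟨ ∑-split (adjacent (suc m)) (χ k) (perms n) ⟩
  ∑ (λ w → [ adjacent (suc m) w ]* χ k w) (perms n) + ∑ (λ w → [ not (adjacent (suc m) w) ]* χ k w) (perms n)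
    ≡⟨ cong₂ _+_ (sym (∑-filterᵇ (adjacent (suc m)) (χ k) (perms n)))
         -- The exchange of m + 1 and m + 2 preserves non-adjacency, so the second sum vanishes.
         (∑-nonadjacent {n} {m} (not ∘ adjacent (suc m)) k (ℕ.n<1+n (suc m))
           (λ w → cong not (adjacent-sw (suc m) w))
           λ {w} _ eq → trans (sym (Bool.not-involutive _)) (cong not eq)) ⟩
  ∑ (χ k) (filterᵇ (adjacent (suc m)) (perms n)) + 0ℤ
    ≡⟨ ℤ.+-identityʳ _ ⟩
  ∑ (χ k) (filterᵇ (adjacent (suc m)) (perms n))
    ≡⟨ ∑-↭ (χ k) (adjacent-perms m) ⟩
  ∑ (χ k) (concatMap insertTop (cartesianProduct (topPairs m) (perms m)))
    ≡⟨ ∑-adjacent-top m k ⟩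
  Δ (euler (suc m) (λ j → ∑ (χ j) (perms m))) k
    ≡⟨ Δ-cong (euler-cong (suc m) λ j → sym (D-∑ m j)) k ⟩
  Δ (euler (suc m) (D m)) k ∎
  where
  open ≡-Reasoning
  n = suc (suc m)

mutual
  -- For `suc m`, the `euler` term inside the two-step recurrence is identified by `D-odd` at `m`;
  -- the two claims climb alternately.
  D-even : ∀ m k → D (suc (suc (m ℕ.+ m))) k ≡ Δ (D (suc (m ℕ.+ m))) k
  -- Both `D 0`, through the empty permutation, and `D 1` are the constant polynomial 1, which
  -- `euler 1` fixes.
  D-even zero k = trans (D-two-step 0 k) (Δ-cong base k)
    where
    base : ∀ k → euler 1 (D 0) k ≡ D 1 k
    base zero          = refl
    base (suc zero)    = refl
    base (suc (suc k)) = cong₂ _+_ (ℤ.*-zeroʳ (1ℤ - + suc (suc k))) (ℤ.*-zeroʳ (+ suc (suc k) + 1ℤ))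
  D-even (suc m) k rewrite ℕ.+-suc m m =
    trans (D-two-step (suc (suc (m ℕ.+ m))) k) (Δ-cong (λ j → sym (D-odd m j)) k)

  -- Moving `Δ` inside `euler` raises its parameter by one, and `D-even` then recognises the
  -- argument as the preceding even row.
  D-odd : ∀ m k → D (suc (suc (suc (m ℕ.+ m)))) k ≡ euler (suc (suc (suc (m ℕ.+ m)))) (D (suc (suc (m ℕ.+ m)))) k
  D-odd m k = begin
    D (suc n) k                    ≡⟨ D-two-step (suc (m ℕ.+ m)) k ⟩
    Δ (euler n (D (suc (m ℕ.+ m)))) k
      ≡⟨ euler-Δ n (D (suc (m ℕ.+ m))) k ⟨
    euler (suc n) (Δ (D (suc (m ℕ.+ m)))) k
      ≡⟨ euler-cong (suc n) (λ j → sym (D-even m j)) k ⟩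
    euler (suc n) (D n) k          ∎
    where
    open ≡-Reasoning
    n = suc (suc (m ℕ.+ m))

-- Boundary conventions and the recurrences for `R`

asc-≤-length : ∀ x xs → asc (x ∷ xs) ≤ length xs
asc-≤-length x []       = z≤n
asc-≤-length x (y ∷ ys) with x <ᵇ y
... | true  = s≤s (asc-≤-length y ys)
... | false = ℕ.m≤n⇒m≤1+n (asc-≤-length y ys)

∑-zero : ∀ (xs : List A) → ∑ (λ _ → 0ℤ) xs ≡ 0ℤ
∑-zero []       = refl
∑-zero (x ∷ xs) = trans (ℤ.+-identityˡ _) (∑-zero xs)

-- A permutation of m + 1 entries has at most m ascents, so the cutoff in `Rc` discards only zeros.
R-vanishes : ∀ {m j} → m < j → R (suc m) j ≡ 0ℤ
R-vanishes {m} {j} m<j = trans (R≡D m j) (trans (D-∑ (suc m) j)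
  (trans (∑-cong (perms (suc m)) χ-zero) (∑-zero (perms (suc m)))))
  where
  χ-zero : ∀ {w} → w ∈ perms (suc m) → χ j w ≡ 0ℤ
  χ-zero {[]} w∈ with () ← length-perm {suc m} w∈
  χ-zero {x ∷ xs} w∈ with refl ← length-perm {suc m} w∈
    rewrite ≢⇒≡ᵇ-false (ℕ.<⇒≢ (ℕ.≤-<-trans (asc-≤-length x xs) m<j)) = refl

Rc-R : ∀ m j → Rc (suc m) (+ j) ≡ R (suc m) j
Rc-R m j with + j ℤ.≤? (+ suc m - + 1)
... | yes _ = refl
... | no j≰m = sym (R-vanishes (ℕ.≰⇒> λ j≤m → j≰m (Data.Integer.+≤+ j≤m)))

-- At k = 0 the index is -1, where `Rc` and `shift` share the default value 0.
Rc-shift : ∀ m k → Rc (suc m) (+ k - + 1) ≡ shift (R (suc m)) k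
Rc-shift m zero    = refl
Rc-shift m (suc k) = Rc-R m k

odd-half : ∀ m → m % 2 ≡ 1 → ∃ λ h → m ≡ suc (h ℕ.+ h)
odd-half (suc zero)    _   = 0 , refl
odd-half (suc (suc m)) odd with h , refl ← odd-half m odd = suc h , cong (2 ℕ.+_) (sym (ℕ.+-suc h h))

even-half : ∀ m → m % 2 ≡ 0 → ∃ λ h → m ≡ h ℕ.+ h
even-half zero          _    = 0 , refl
even-half (suc (suc m)) even with h , refl ← even-half m even = suc h , cong suc (sym (ℕ.+-suc h h))

R-euler : ∀ m k → m % 2 ≡ 1 → R (suc (suc m)) k ≡ euler (suc (suc m)) (R (suc m)) k
R-euler m k odd with h , refl ← odd-half m odd = begin
  R (3 ℕ.+ (h ℕ.+ h)) k                                ≡⟨ R≡D (2 ℕ.+ (h ℕ.+ h)) k ⟩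
  D (3 ℕ.+ (h ℕ.+ h)) k                                ≡⟨ D-odd h k ⟩
  euler (3 ℕ.+ (h ℕ.+ h)) (D (2 ℕ.+ (h ℕ.+ h))) k
    ≡⟨ euler-cong (3 ℕ.+ (h ℕ.+ h)) (R≡D (suc (h ℕ.+ h))) k ⟨
  euler (3 ℕ.+ (h ℕ.+ h)) (R (2 ℕ.+ (h ℕ.+ h))) k      ∎
  where
  open ≡-Reasoning

R-Δ : ∀ m k → m % 2 ≡ 0 → R (suc (suc m)) k ≡ Δ (R (suc m)) k
R-Δ m k even with h , refl ← even-half m even = begin
  R (2 ℕ.+ (h ℕ.+ h)) k        ≡⟨ R≡D (suc (h ℕ.+ h)) k ⟩
  D (2 ℕ.+ (h ℕ.+ h)) k        ≡⟨ D-even h k ⟩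
  Δ (D (suc (h ℕ.+ h))) k      ≡⟨ Δ-cong (R≡D (h ℕ.+ h)) k ⟨
  Δ (R (suc (h ℕ.+ h))) k      ∎
  where
  open ≡-Reasoning

theorem4p3 : ((n k : ℕ) → 1 ≤ n → k ≤ n ∸ 1 → R n k ≡ D n k)
    × ((n k : ℕ) → 2 ≤ n → k ≤ n ∸ 1 →
    (n % 2 ≡ 1 → Rc n (+ k) ≡ + (n ∸ k) * Rc (n ∸ 1) (+ k - + 1) + + (k Data.Nat.+ 1) * Rc (n ∸ 1) (+ k))
    × (n % 2 ≡ 0 → Rc n (+ k) ≡ Rc (n ∸ 1) (+ k - + 1) - Rc (n ∸ 1) (+ k)))
theorem4p3 = (λ { (suc n) k _ _ → R≡D n k }) ,
  λ { (suc zero) k (s≤s ()) ; (suc (suc m)) k _ k≤ → odd m k k≤ , even m k }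
  where
  odd : ∀ m k → k ≤ suc m → m % 2 ≡ 1 → Rc (suc (suc m)) (+ k) ≡
    + (suc (suc m) ∸ k) * Rc (suc m) (+ k - + 1) + + (k Data.Nat.+ 1) * Rc (suc m) (+ k)
  odd m k k≤ m-odd = begin
    Rc (suc (suc m)) (+ k)                     ≡⟨ Rc-R (suc m) k ⟩
    R (suc (suc m)) k                          ≡⟨ R-euler m k m-odd ⟩
    euler (suc (suc m)) (R (suc m)) k
      -- The bound on k makes the truncated difference agree with the integer difference in `euler`.
      ≡⟨ cong₂ _+_ (cong₂ _*_ (trans (ℤ.m-n≡m⊖n (suc (suc m)) k) (ℤ.⊖-≥ (ℕ.m≤n⇒m≤1+n k≤))) (sym (Rc-shift m k)))
                   (cong (+ (k ℕ.+ 1) *_) (sym (Rc-R m k))) ⟩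
    + (suc (suc m) ∸ k) * Rc (suc m) (+ k - + 1) + + (k ℕ.+ 1) * Rc (suc m) (+ k) ∎
    where open ≡-Reasoning
  even : ∀ m k → m % 2 ≡ 0 → Rc (suc (suc m)) (+ k) ≡ Rc (suc m) (+ k - + 1) - Rc (suc m) (+ k)
  even m k m-even = begin
    Rc (suc (suc m)) (+ k)                     ≡⟨ Rc-R (suc m) k ⟩
    R (suc (suc m)) k                          ≡⟨ R-Δ m k m-even ⟩
    Δ (R (suc m)) k                            ≡⟨ cong₂ _-_ (Rc-shift m k) (Rc-R m k) ⟨
    Rc (suc m) (+ k - + 1) - Rc (suc m) (+ k)  ∎
    where open ≡-Reasoning
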